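{- Let $d\ge 2$, $t\ge 2$, $n\ge 5$ be integers with $n\ge 2t$. Define $S\subseteq\mathcal A_d^n$ as the union of $$\{x\in\mathcal A_d^n : \text{for some } m\in\mathcal A_d \text{ and some integer } 1\le \ell\le t,\ x^{(t,m)}(t+1-\ell:n-1)\text{ is } \ell\text{ -periodic, but } x^{(t,m)}(t+1-\ell:n-1)\oplus (x_n+m)\text{ is not } \ell\text{ -periodic}\}$$ and $$\{x\in\mathcal A_d^n : x_t\ne x_n \text{ and } x^{(t,m)}(t+1-\ell:n-1)\text{ is not } \ell\text{ -periodic for any } m\in\mathcal A_d \text{ and any integer } 1\le\ell\le t\}.$$ Then $S$ is a $t$-identifying code of $\vec{\mathcal B}(d,n)$ of size $d^{n-1}(d-1)$, and no $t$-identifying code of $\vec{\mathcal B}(d,n)$ has fewer vertices.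
   Context: $\mathcal A_d=\{0,1,\dots,d-1\}$; $\mathcal A_d^n$ is the set of strings $x=x_1\cdots x_n$ over $\mathcal A_d$; letter sums such as $x_n+m$ are taken modulo $d$. The directed de Bruijn graph $\vec{\mathcal B}(d,n)$ has vertex set $\mathcal A_d^n$ and an arc from $x_1\cdots x_n$ to $y_1\cdots y_n$ iff $x_2\cdots x_n=y_1\cdots y_{n-1}$. $\vec d(u,v)$ is the length of a shortest directed walk from $u$ to $v$; $B_t^-(v)=\{u:\vec d(u,v)\le t\}$; for $S\subseteq V$, $\mathrm{ID}_S(v)=B_t^-(v)\cap S$; a $t$-identifying code is a set $S$ with $\mathrm{ID}_S(v)\ne\emptyset$ for all $v$ and $\mathrm{ID}_S(u)\ne\mathrm{ID}_S(v)$ for all $u\ne v$. String notation: $x(a:b)=x_ax_{a+1}\cdots x_b$; $\oplus$ denotes concatenation (a single letter is a string of length 1). For $w\in\mathcal A_d^n$, a position $t$ and $m\in\mathcal A_d$, $w^{(t,m)}$ is the string obtained from $w$ by replacing $w_t$ by $(w_t+m)\bmod d$ and leaving all other letters unchanged. A string $w$ of length $L$ has period length $\ell$ (a positive integer) if $L\ge 2\ell$ and $w_i=w_{i+\ell}$ for all $1\le i\le L-\ell$; $w$ is $\ell$-periodic if it has period length $\ell$ and has no period length $k$ with $k<\ell$. -}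

module Defs where

open import Data.Nat using (ℕ; zero; suc; _+_; _*_; _∸_; _≤_; _<_)
open import Data.Nat.DivMod using (_%_; m%n<n)
open import Data.Fin using (Fin; toℕ; fromℕ<)
open import Data.Vec using (Vec; []; _∷_; toList)
open import Data.List as L using (List; length; take; drop; _++_)
open import Data.Maybe using (Maybe; just; nothing)
open import Data.Product using (Σ; ∃; _×_; _,_)
open import Data.Empty using (⊥)
open import Relation.Nullary using (¬_)
open import Relation.Binary.PropositionalEquality using (_≡_; _≢_)
open import Function.Bundles using (_⇔_)

Str : ℕ → ℕ → Set
Str d n = Vec (Fin d) n

_+ᵈ_ : ∀ {d} → Fin d → Fin d → Fin d
_+ᵈ_ {suc d} i j = fromℕ< (m%n<n (toℕ i + toℕ j) (suc d))

-- 1-indexed letter of a list (nothing if out of range)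
letter : ∀ {A : Set} → List A → ℕ → Maybe A
letter L.[] _ = nothing
letter (x L.∷ xs) zero = nothing
letter (x L.∷ xs) (suc zero) = just x
letter (x L.∷ xs) (suc (suc i)) = letter xs (suc i)

_!_ : ∀ {d n} → Str d n → ℕ → Maybe (Fin d)
x ! i = letter (toList x) i

-- x(a:b) = x_a x_{a+1} ... x_b  (1-indexed, as a list)
sub : ∀ {d n} → Str d n → ℕ → ℕ → List (Fin d)
sub x a b = take (suc b ∸ a) (drop (a ∸ 1) (toList x))

modAt : ∀ {A : Set} {n} → ℕ → (A → A) → Vec A n → Vec A n
modAt _ f [] = []
modAt zero f (x ∷ xs) = x ∷ xs
modAt (suc zero) f (x ∷ xs) = f x ∷ xs
modAt (suc (suc i)) f (x ∷ xs) = x ∷ modAt (suc i) f xs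

upd : ∀ {d n} → Str d n → ℕ → Fin d → Str d n
upd w t m = modAt t (λ c → c +ᵈ m) w

HasPeriod : ∀ {A : Set} → ℕ → List A → Set
HasPeriod ℓ w = (1 ≤ ℓ) × (ℓ + ℓ ≤ length w)
  × (∀ i → 1 ≤ i → i ≤ length w ∸ ℓ → letter w i ≡ letter w (i + ℓ))

Periodic : ∀ {A : Set} → ℕ → List A → Set
Periodic ℓ w = HasPeriod ℓ w × (∀ k → k < ℓ → ¬ HasPeriod k w)

Arc : ∀ {d n} → Str d n → Str d n → Set
Arc {n = n} x y = drop 1 (toList x) ≡ take (n ∸ 1) (toList y)

data Walk {d n : ℕ} : ℕ → Str d n → Str d n → Set where
  here : ∀ {u} → Walk zero u u
  step : ∀ {k u w v} → Arc u w → Walk k w v → Walk (suc k) u v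

InBall : ∀ {d n} → ℕ → Str d n → Str d n → Set
InBall t u v = ∃ λ k → k ≤ t × Walk k u v

IsIdCode : ∀ {d n} → ℕ → (Str d n → Set) → Set
IsIdCode {d} {n} t S =
  (∀ (v : Str d n) → ∃ λ u → InBall t u v × S u)
  × (∀ (u v : Str d n) → u ≢ v →
       ¬ (∀ w → (InBall t w u × S w) ⇔ (InBall t w v × S w)))

S₁ : ∀ {d n} → ℕ → Str d n → Set
S₁ {d} {n} t x = Σ (Fin d) λ m → Σ ℕ λ ℓ → (1 ≤ ℓ) × (ℓ ≤ t)
  × Periodic ℓ (sub (upd x t m) (suc t ∸ ℓ) (n ∸ 1))
  × ¬ Periodic ℓ (sub (upd x t m) (suc t ∸ ℓ) (n ∸ 1)
                   ++ L.map (λ c → c +ᵈ m) (sub x n n))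

S₂ : ∀ {d n} → ℕ → Str d n → Set
S₂ {d} {n} t x = (x ! t ≢ x ! n)
  × (∀ (m : Fin d) ℓ → 1 ≤ ℓ → ℓ ≤ t →
       ¬ Periodic ℓ (sub (upd x t m) (suc t ∸ ℓ) (n ∸ 1)))

data InS {d n : ℕ} (t : ℕ) (x : Str d n) : Set where
  inS₁ : S₁ t x → InS t x
  inS₂ : S₂ t x → InS t x

-- Whether a window is ℓ-periodic for some shift m depends on neither x_t nor x_n,
-- and the minimal such ℓ determines m from x_t.  So with all other letters fixed,
-- membership in S excludes exactly one value of x_n for each x_t, and exactly one
-- value of x_t for each x_n; the first gives the size of S.  Two strings differing
-- only in the last letter have balls differing only in these two strings, so any
-- code omits at most one string per prefix of length n − 1.
--
-- Separation.  Let u ≠ v first differ at position r.  If r > n − t, then for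
-- b ≠ u₁ one of the strings b…b u, b…b v (u and v moved right to put that difference
-- at position n) lies in S, and it lies in the other ball only if it ends in a
-- window of period at most t that reaches x_n; such strings are not in S.  If
-- r ≤ n − t, then the strings b…b c u with b ≠ v₁ lie t steps from u, and those in
-- S can reach v only after t − 1 steps and with c = v₁.  This forces u and v to
-- alternate as abab… and baba…, and then a…a abab… is a member of S that
-- separates them.
module Submission where

open import Defs
open import Data.Empty using (⊥)
open import Data.Fin as Fin using (Fin; zero; suc; toℕ; fromℕ<)
import Data.Fin.Properties as Fin
open import Data.List using (List; length; _∷_; []; cartesianProductWith; allFin)
import Data.List as L
import Data.List.Membership.DecPropositional as DecMembership
open import Data.List.Membership.Propositional using (_∈_)
open import Data.List.Membership.Propositional.Properties using (∈-cartesianProductWith⁺; ∈-cartesianProductWith⁻; ∈-allFin; ∈-∃++; ∈-++⁻; ∈-++⁺ˡ; ∈-++⁺ʳ)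
open import Data.List.Properties using (length-take; length-drop; length-++; length-map; length-++-sucʳ; length-tabulate)
import Data.List.Relation.Unary.All as All
import Data.List.Relation.Unary.AllPairs as AllPairs
open import Data.List.Relation.Unary.Any using (here; there)
open import Data.List.Relation.Unary.Unique.Propositional using (Unique)
import Data.List.Relation.Unary.Unique.Propositional.Properties as Unique
open import Data.Maybe using (just)
open import Data.Maybe.Properties using (just-injective)
open import Data.Nat using (ℕ; zero; suc; 2+; _+_; _*_; _∸_; _^_; _⊓_; _≤_; _<_; z≤n; s≤s; z<s; s≤s⁻¹; _≟_; _≤?_; _<?_)
open import Data.Nat.DivMod using (_%_; m%n<n; %-distribˡ-+; m%n%n≡m%n; [m+n]%n≡m%n; m<n⇒m%n≡m)
open import Data.Nat.Properties
open import Data.Nat.Tactic.RingSolver using (solve; solve-∀)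
open import Data.Product using (Σ; ∃; _×_; _,_; proj₁; proj₂)
open import Data.Sum using (_⊎_; inj₁; inj₂; [_,_]′)
open import Data.Vec as V using (Vec; toList; _∷ʳ_)
import Data.Vec.Properties as Vec
open import Function.Base using (_∘_; case_of_)
open import Function.Bundles using (_⇔_; mk⇔; Equivalence)
import Function.Properties.Equivalence as ⇔
open import Relation.Binary.Definitions using (tri<; tri≈; tri>)
open import Relation.Binary.PropositionalEquality using (_≡_; _≢_; refl; sym; trans; cong; cong₂; subst; subst₂; module ≡-Reasoning)
open import Relation.Nullary using (¬_; Dec; yes; no; contradiction)
open import Relation.Nullary.Decidable using (_×-dec_; _→-dec_; ¬?; map′; decidable-stable)

-- a ≤ b is a sum of hypotheses and k the slack; eq is left to the ring solver.
≤-cert : ∀ {a b x y} k → a ≤ b → k + (x + b) ≡ y + a → x ≤ y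
≤-cert {a} {b} {x} {y} k a≤b eq = +-cancelʳ-≤ b x y
  (≤-trans (m≤n+m (x + b) k) (≤-trans (≤-reflexive eq) (+-monoʳ-≤ y a≤b)))

least : ∀ {P : ℕ → Set} → (∀ n → Dec (P n)) → ∀ N →
  (∃ λ n → n < N × P n × (∀ k → k < n → ¬ P k)) ⊎ (∀ k → k < N → ¬ P k)
least P? zero = inj₂ λ _ ()
least P? (suc N) with least P? N
... | inj₁ (n , n<N , Pn , min) = inj₁ (n , m≤n⇒m≤1+n n<N , Pn , min)
... | inj₂ none with P? N
...   | yes PN = inj₁ (N , ≤-refl , PN , none)
...   | no ¬PN = inj₂ λ k k<1+N Pk → case m≤n⇒m<n∨m≡n (s≤s⁻¹ k<1+N) of λ where
          (inj₁ k<N) → none k k<N Pk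
          (inj₂ refl) → ¬PN Pk

-- Addition of letters modulo d.

module _ {D : ℕ} where

  private n = suc D

  toℕ-+ᵈ : (i j : Fin n) → toℕ (i +ᵈ j) ≡ (toℕ i + toℕ j) % n
  toℕ-+ᵈ i j = Fin.toℕ-fromℕ< _

  +ᵈ-comm : (i j : Fin n) → i +ᵈ j ≡ j +ᵈ i
  +ᵈ-comm i j = Fin.toℕ-injective (trans (toℕ-+ᵈ i j)
    (trans (cong (_% n) (+-comm (toℕ i) (toℕ j))) (sym (toℕ-+ᵈ j i))))

  [i+j]+[n∸j]%n : (i j : Fin n) → ((toℕ i + toℕ j) % n + (n ∸ toℕ j)) % n ≡ toℕ i
  [i+j]+[n∸j]%n i j = begin
    ((a + b) % n + (n ∸ b)) % n          ≡⟨ %-distribˡ-+ ((a + b) % n) (n ∸ b) n ⟩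
    ((a + b) % n % n + (n ∸ b) % n) % n  ≡⟨ cong (λ z → (z + (n ∸ b) % n) % n) (m%n%n≡m%n (a + b) n) ⟩
    ((a + b) % n + (n ∸ b) % n) % n      ≡⟨ %-distribˡ-+ (a + b) (n ∸ b) n ⟨
    ((a + b) + (n ∸ b)) % n              ≡⟨ cong (_% n) (+-assoc a b (n ∸ b)) ⟩
    (a + (b + (n ∸ b))) % n              ≡⟨ cong (λ z → (a + z) % n) (m+[n∸m]≡n (<⇒≤ (Fin.toℕ<n j))) ⟩
    (a + n) % n                          ≡⟨ [m+n]%n≡m%n a n ⟩
    a % n                                ≡⟨ m<n⇒m%n≡m (Fin.toℕ<n i) ⟩
    a                                    ∎
    where
    open ≡-Reasoning
    a = toℕ i
    b = toℕ j

  +ᵈ-cancelʳ : (m i j : Fin n) → i +ᵈ m ≡ j +ᵈ m → i ≡ j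
  +ᵈ-cancelʳ m i j eq = Fin.toℕ-injective (begin
    toℕ i                                          ≡⟨ [i+j]+[n∸j]%n i m ⟨
    ((toℕ i + toℕ m) % n + (n ∸ toℕ m)) % n        ≡⟨ cong (λ z → (z + (n ∸ toℕ m)) % n)
                                                        (trans (sym (toℕ-+ᵈ i m)) (trans (cong toℕ eq) (toℕ-+ᵈ j m))) ⟩
    ((toℕ j + toℕ m) % n + (n ∸ toℕ m)) % n        ≡⟨ [i+j]+[n∸j]%n j m ⟩
    toℕ j                                          ∎)
    where open ≡-Reasoning

  +ᵈ-cancelˡ : (m i j : Fin n) → m +ᵈ i ≡ m +ᵈ j → i ≡ j
  +ᵈ-cancelˡ m i j eq = +ᵈ-cancelʳ m i j (trans (+ᵈ-comm i m) (trans eq (+ᵈ-comm m j)))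

  +ᵈ-solveˡ : (i j : Fin n) → ∃ λ m → m +ᵈ i ≡ j
  +ᵈ-solveˡ i j = m , Fin.toℕ-injective (begin
    toℕ (m +ᵈ i)                                  ≡⟨ toℕ-+ᵈ m i ⟩
    (toℕ m + a) % n                               ≡⟨ cong (λ z → (z + a) % n) (Fin.toℕ-fromℕ< (m%n<n (b + (n ∸ a)) n)) ⟩
    ((b + (n ∸ a)) % n + a) % n                   ≡⟨ %-distribˡ-+ ((b + (n ∸ a)) % n) a n ⟩
    ((b + (n ∸ a)) % n % n + a % n) % n           ≡⟨ cong (λ z → (z + a % n) % n) (m%n%n≡m%n (b + (n ∸ a)) n) ⟩
    ((b + (n ∸ a)) % n + a % n) % n               ≡⟨ %-distribˡ-+ (b + (n ∸ a)) a n ⟨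
    (b + (n ∸ a) + a) % n                         ≡⟨ cong (_% n) (+-assoc b (n ∸ a) a) ⟩
    (b + (n ∸ a + a)) % n                         ≡⟨ cong (λ z → (b + z) % n) (m∸n+n≡m (<⇒≤ (Fin.toℕ<n i))) ⟩
    (b + n) % n                                   ≡⟨ [m+n]%n≡m%n b n ⟩
    b % n                                         ≡⟨ m<n⇒m%n≡m (Fin.toℕ<n j) ⟩
    b                                             ∎)
    where
    open ≡-Reasoning
    a = toℕ i
    b = toℕ j
    m = fromℕ< (m%n<n (b + (n ∸ a)) n)

  +ᵈ-solveʳ : (i j : Fin n) → ∃ λ m → i +ᵈ m ≡ j
  +ᵈ-solveʳ i j = let m , eq = +ᵈ-solveˡ i j in m , trans (+ᵈ-comm i m) eq

  +ᵈ-identityʳ : (i : Fin n) → i +ᵈ zero ≡ i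
  +ᵈ-identityʳ i = Fin.toℕ-injective (trans (toℕ-+ᵈ i zero)
    (trans (cong (_% n) (+-identityʳ (toℕ i))) (m<n⇒m%n≡m (Fin.toℕ<n i))))

  -- A shift with one fixed letter is the shift by `zero`.
  +ᵈ-fixes : (m i j : Fin n) → i +ᵈ m ≡ i → j +ᵈ m ≡ j
  +ᵈ-fixes m i j eq = subst (λ z → j +ᵈ z ≡ j)
    (+ᵈ-cancelˡ i zero m (trans (+ᵈ-identityʳ i) (sym eq))) (+ᵈ-identityʳ j)

-- Words with two periods.

-- The two periods are reduced as in Euclid's algorithm; this is the extremal
-- case, length a + b ∸ 1, of the Fine–Wilf theorem.
periods⇒≡ : ∀ {A : Set} (g : ℕ → A) fuel a b → a + b ≤ fuel → 0 < a → 0 < b →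
  (∀ r → 0 < r → r < b → g r ≡ g (r + a)) →
  (∀ r → 0 < r → r < a → g r ≡ g (r + b)) → g a ≡ g b

periods-subtract : ∀ {A : Set} (g : ℕ → A) fuel a b → a < b → a + b ≤ suc fuel → 0 < a →
  (∀ r → 0 < r → r < b → g r ≡ g (r + a)) →
  (∀ r → 0 < r → r < a → g r ≡ g (r + b)) → g a ≡ g b

periods⇒≡ g zero (suc a) b () 0<a 0<b pa pb
periods⇒≡ g (suc fuel) a b a+b≤ 0<a 0<b pa pb with <-cmp a b
... | tri≈ _ refl _ = refl
... | tri< a<b _ _ = periods-subtract g fuel a b a<b a+b≤ 0<a pa pb
... | tri> _ _ b<a = sym (periods-subtract g fuel b a b<a
  (subst (_≤ suc fuel) (+-comm a b) a+b≤) 0<b pb pa)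

periods-subtract g fuel a b a<b a+b≤ 0<a pa pb with m≤n⇒∃[o]m+o≡n a<b
-- Here `b` is `a + suc c`. Going right by `b` and left by `a` gives the smaller period `suc c`; a
-- last step of `a` leads from `g (suc c)` to `g b`.
... | c , refl = trans
  (periods⇒≡ g fuel a (suc c)
    (≤-cert 0 (+-mono-≤ a+b≤ 0<a) (solve (a ∷ c ∷ fuel ∷ []))) 0<a z<s
    (λ r 0<r r<c → pa r 0<r (≤-trans r<c (≤-cert a (z≤n {0}) (solve (a ∷ c ∷ [])))))
    (λ r 0<r r<a → trans (pb r 0<r r<a)
      (trans (cong g {r + (suc a + c)} {r + suc c + a} (solve (r ∷ a ∷ c ∷ [])))
        (sym (pa (r + suc c) (≤-trans 0<r (m≤m+n r (suc c)))
          (≤-cert 0 r<a (solve (r ∷ a ∷ c ∷ []))))))))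
  (trans (pa (suc c) z<s (≤-cert 0 0<a (solve (a ∷ c ∷ []))))
    (cong g (solve (a ∷ c ∷ []))))

-- Membership in the code as a condition on letters.

-- Positions count from 0: T = t − 1 and e = n − 1 are the positions of x_t and x_n.
module Letters {D : ℕ} (T e : ℕ) where

  Word = ℕ → Fin (suc D)

  -- Period ℓ on the window without its position T, where a suitable m always exists.
  Shifted : Word → ℕ → Set
  Shifted X ℓ = ∀ i j → i + ℓ ≡ j → i ≢ T → T < j → j < e → X i ≡ X j

  -- `T + ℓ < e` is the requirement that the window, at positions `T + 1 - ℓ` to `e - 1`, has length
  -- at least 2ℓ. For n ≥ 2t and ℓ ≤ t it fails only if ℓ = t and n = 2t.
  Admissible : ℕ → Set
  Admissible ℓ = 1 ≤ ℓ × ℓ ≤ suc T × T + ℓ < e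

  Minimal : Word → ℕ → Set
  Minimal X ℓ = Admissible ℓ × Shifted X ℓ × (∀ k → 1 ≤ k → k < ℓ → ¬ Shifted X k)

  -- The window starts just after `T - ℓ`, so `T` occurs in the single pair `(T, T + ℓ)` and the
  -- equation fixes `m`. Appending x_n + m adds only the pair `(e - ℓ, e)`, which the inequality
  -- breaks.
  Good₁ Good₂ Good : Word → Set
  Good₁ X = ∃ λ ℓ → ∃ λ m → Minimal X ℓ × X T +ᵈ m ≡ X (T + ℓ) × X e +ᵈ m ≢ X (e ∸ ℓ)
  Good₂ X = (∀ ℓ → Admissible ℓ → ¬ Shifted X ℓ) × X T ≢ X e
  Good X = Good₁ X ⊎ Good₂ X

  admissible? : ∀ ℓ → Dec (Admissible ℓ)
  admissible? ℓ = (1 ≤? ℓ) ×-dec (ℓ ≤? suc T) ×-dec (T + ℓ <? e)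

  shifted? : ∀ X ℓ → Dec (Shifted X ℓ)
  shifted? X ℓ = map′ to (λ sh _ i≢T T<j j<e → sh _ _ refl i≢T T<j j<e)
    (allUpTo? (λ i → ¬? (i ≟ T) →-dec ((T <? i + ℓ) →-dec ((i + ℓ <? e) →-dec (X i Fin.≟ X (i + ℓ))))) e)
    where
    to : (∀ {i} → i < e → i ≢ T → T < i + ℓ → i + ℓ < e → X i ≡ X (i + ℓ)) → Shifted X ℓ
    to f i j refl i≢T T<j j<e = f (≤-<-trans (m≤m+n i ℓ) j<e) i≢T T<j j<e

  classify : ∀ X → ∃ (Minimal X) ⊎ (∀ ℓ → Admissible ℓ → ¬ Shifted X ℓ)
  classify X with least (λ ℓ → admissible? ℓ ×-dec shifted? X ℓ) (suc (suc T))
  ... | inj₂ none = inj₂ λ ℓ adm sh → none ℓ (s≤s (proj₁ (proj₂ adm))) (adm , sh)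
  ... | inj₁ (ℓ , _ , (adm@(_ , ℓ≤1+T , T+ℓ<e) , sh) , min) = inj₁ (ℓ , adm , sh , λ k 1≤k k<ℓ shk →
    min k k<ℓ ((1≤k , ≤-trans (<⇒≤ k<ℓ) ℓ≤1+T , <-trans (+-monoʳ-< T k<ℓ) T+ℓ<e) , shk))

  Minimal-unique : ∀ {X ℓ ℓ′} → Minimal X ℓ → Minimal X ℓ′ → ℓ ≡ ℓ′
  Minimal-unique {ℓ = ℓ} {ℓ′} ((1≤ℓ , _) , sh , min) ((1≤ℓ′ , _) , sh′ , min′) with <-cmp ℓ ℓ′
  ... | tri< ℓ<ℓ′ _ _ = contradiction sh (min′ ℓ 1≤ℓ ℓ<ℓ′)
  ... | tri≈ _ ℓ≡ℓ′ _ = ℓ≡ℓ′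
  ... | tri> _ _ ℓ′<ℓ = contradiction sh′ (min ℓ′ 1≤ℓ′ ℓ′<ℓ)

  infix 4 _≈_
  -- Agreement wherever `Shifted` can look: it reads neither position `T` nor anything from `e` on.
  _≈_ : Word → Word → Set
  X ≈ Y = ∀ i → i < e → i ≢ T → X i ≡ Y i

  ≈-sym : ∀ {X Y} → X ≈ Y → Y ≈ X
  ≈-sym X≈Y i i<e i≢T = sym (X≈Y i i<e i≢T)

  Shifted-resp : ∀ {X Y ℓ} → X ≈ Y → Shifted X ℓ → Shifted Y ℓ
  Shifted-resp {ℓ = ℓ} X≈Y sh i j i+ℓ≡j i≢T T<j j<e = trans
    (sym (X≈Y i (≤-<-trans (≤-trans (m≤m+n i ℓ) (≤-reflexive i+ℓ≡j)) j<e) i≢T))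
    (trans (sh i j i+ℓ≡j i≢T T<j j<e) (X≈Y j j<e (>⇒≢ T<j)))

  Minimal-resp : ∀ {X Y ℓ} → X ≈ Y → Minimal X ℓ → Minimal Y ℓ
  Minimal-resp X≈Y (adm , sh , min) =
    adm , Shifted-resp X≈Y sh , λ k 1≤k k<ℓ → min k 1≤k k<ℓ ∘ Shifted-resp (≈-sym X≈Y)

  module _ {X Y : Word} {ℓ : ℕ} (X≈Y : X ≈ Y) (min : Minimal X ℓ) where

    private
      1≤ℓ   = proj₁ (proj₁ min)
      T+ℓ<e = proj₂ (proj₂ (proj₁ min))

      X[T+ℓ] : X (T + ℓ) ≡ Y (T + ℓ)
      X[T+ℓ] = X≈Y (T + ℓ) T+ℓ<e (>⇒≢ (m<m+n T 1≤ℓ))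

      T<e∸ℓ : T < e ∸ ℓ
      T<e∸ℓ = subst (_< e ∸ ℓ) (m+n∸n≡m T ℓ) (∸-monoˡ-< T+ℓ<e (m≤n+m ℓ T))

      X[e∸ℓ] : X (e ∸ ℓ) ≡ Y (e ∸ ℓ)
      X[e∸ℓ] = X≈Y (e ∸ ℓ) (∸-monoʳ-< 1≤ℓ (≤-trans (m≤n+m ℓ T) (<⇒≤ T+ℓ<e))) (>⇒≢ T<e∸ℓ)

    -- `Y` inherits the minimal `ℓ` of `X`, and a minimal `ℓ` is unique, so only the two conditions
    -- on `Y T` and `Y e` remain.
    Good⇒link : Good Y → ∃ λ m → Y T +ᵈ m ≡ X (T + ℓ) × Y e +ᵈ m ≢ X (e ∸ ℓ)
    Good⇒link (inj₁ (ℓ′ , m , min′ , link , ne)) with Minimal-unique min′ (Minimal-resp X≈Y min)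
    ... | refl = m , trans link (sym X[T+ℓ]) , λ eq → ne (trans eq X[e∸ℓ])
    Good⇒link (inj₂ (none , _)) =
      contradiction (Shifted-resp X≈Y (proj₁ (proj₂ min))) (none ℓ (proj₁ min))

    link⇒Good : ∀ m → Y T +ᵈ m ≡ X (T + ℓ) → Y e +ᵈ m ≢ X (e ∸ ℓ) → Good Y
    link⇒Good m link ne = inj₁
      (ℓ , m , Minimal-resp X≈Y min , trans link X[T+ℓ] , λ eq → ne (trans eq (sym X[e∸ℓ])))

  module _ {X Y : Word} (X≈Y : X ≈ Y) (none : ∀ ℓ → Admissible ℓ → ¬ Shifted X ℓ) where

    Good⇒≢ : Good Y → Y T ≢ Y e
    Good⇒≢ (inj₁ (ℓ , _ , (adm , sh , _) , _)) =
      contradiction (Shifted-resp (≈-sym X≈Y) sh) (none ℓ adm)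
    Good⇒≢ (inj₂ (_ , ne)) = ne

    ≢⇒Good : Y T ≢ Y e → Good Y
    ≢⇒Good ne = inj₂ ((λ ℓ adm → none ℓ adm ∘ Shifted-resp (≈-sym X≈Y)) , ne)

  -- The letters before `e` settle whether a `Shifted` period exists, then the least `ℓ`, then `m`.
  -- The last letter enters only the final inequality, which rules out one value: `X T`, or the
  -- letter that `m` carries to `X (e ∸ ℓ)`.
  forbidden-last : T < e → ∀ X → ∃ λ β → ∀ Y → (∀ i → i < e → X i ≡ Y i) → Good Y ⇔ (Y e ≢ β)
  forbidden-last T<e X with classify X
  ... | inj₂ none = X T , λ Y X≡Y →
    let X≈Y = λ i i<e _ → X≡Y i i<e in mk⇔
      (λ good eq → Good⇒≢ X≈Y none good (trans (sym (X≡Y T T<e)) (sym eq)))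
      (λ ne → ≢⇒Good X≈Y none λ eq → ne (trans (sym eq) (sym (X≡Y T T<e))))
  ... | inj₁ (ℓ , min) with +ᵈ-solveʳ (X T) (X (T + ℓ))
  ...   | m , link with +ᵈ-solveˡ m (X (e ∸ ℓ))
  ...     | β , β-eq = β , λ Y X≡Y →
    let X≈Y = λ i i<e _ → X≡Y i i<e
        link′ = trans (cong (_+ᵈ m) (sym (X≡Y T T<e))) link
    in mk⇔
      (λ good eq → case Good⇒link X≈Y min good of λ where
        (m′ , l , ne) → ne (trans (cong (Y e +ᵈ_) (+ᵈ-cancelˡ (Y T) m′ m (trans l (sym link′))))
                                  (trans (cong (_+ᵈ m) eq) β-eq)))
      (λ ne → link⇒Good X≈Y min m link′ λ eq → ne (+ᵈ-cancelʳ m (Y e) β (trans eq (sym β-eq))))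

  -- With the last letter fixed, the one shift that fails is known: it carries `X e` to `X (e ∸ ℓ)`.
  -- The forbidden `β` is the letter at `T` that this shift links to `X (T + ℓ)`.
  forbidden-at-T : T < e → ∀ X → ∃ λ β → ∀ Y → (∀ i → i ≤ e → i ≢ T → X i ≡ Y i) → Good Y ⇔ (Y T ≢ β)
  forbidden-at-T T<e X with classify X
  ... | inj₂ none = X e , λ Y X≡Y →
    let X≈Y = λ i i<e → X≡Y i (<⇒≤ i<e)
        Xe≡Ye = X≡Y e ≤-refl (>⇒≢ T<e)
    in mk⇔
      (λ good eq → Good⇒≢ X≈Y none good (trans eq Xe≡Ye))
      (λ ne → ≢⇒Good X≈Y none λ eq → ne (trans eq (sym Xe≡Ye)))
  ... | inj₁ (ℓ , min) with +ᵈ-solveʳ (X e) (X (e ∸ ℓ))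
  ...   | m , Xe+m with +ᵈ-solveˡ m (X (T + ℓ))
  ...     | β , β-eq = β , λ Y X≡Y →
    let X≈Y = λ i i<e → X≡Y i (<⇒≤ i<e)
        Ye+m = trans (cong (_+ᵈ m) (sym (X≡Y e ≤-refl (>⇒≢ T<e)))) Xe+m
    in mk⇔
      (λ good eq → case Good⇒link X≈Y min good of λ where
        (m′ , l , ne) → ne (trans (cong (Y e +ᵈ_)
          (+ᵈ-cancelˡ β m′ m (trans (subst (λ z → z +ᵈ m′ ≡ X (T + ℓ)) eq l) (sym β-eq)))) Ye+m))
      (λ ne → case +ᵈ-solveʳ (Y T) (X (T + ℓ)) of λ where
        (m′ , l) → link⇒Good X≈Y min m′ l λ eq → ne (+ᵈ-cancelʳ m (Y T) β
          (trans (subst (λ z → Y T +ᵈ z ≡ X (T + ℓ)) (+ᵈ-cancelˡ (Y e) m′ m (trans eq (sym Ye+m))) l)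
                 (sym β-eq))))

  -- The letters to the right of `T` are fed to `periods⇒≡` with periods `ℓ` and `o`; the shift by
  -- `o` arises from going left by `ℓ` and right by `ℓ + o`.
  Shifted²⇒≡ : ∀ {X} ℓ o → 0 < ℓ → 0 < o → ℓ + o ≤ suc T → T + (ℓ + o) ≤ e →
    Shifted X ℓ → Shifted X (ℓ + o) → X (T + ℓ) ≡ X (T + o)
  Shifted²⇒≡ {X} ℓ o 0<ℓ 0<o ℓ+o≤1+T T+ℓ+o≤e sh sh′ =
    periods⇒≡ (λ r → X (T + r)) (ℓ + o) ℓ o ≤-refl 0<ℓ 0<o forward backward
    where
    forward : ∀ r → 0 < r → r < o → X (T + r) ≡ X (T + (r + ℓ))
    forward r 0<r r<o = sh (T + r) (T + (r + ℓ)) (+-assoc T r ℓ) (>⇒≢ (m<m+n T 0<r))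
      (≤-cert ℓ 0<r (solve (T ∷ r ∷ ℓ ∷ [])))
      (≤-cert 0 (+-mono-≤ r<o T+ℓ+o≤e) (solve (T ∷ r ∷ ℓ ∷ o ∷ e ∷ [])))

    backward : ∀ r → 0 < r → r < ℓ → X (T + r) ≡ X (T + (r + o))
    -- `q` is `T - ℓ`. The detour from `T + r` passes through `q + r`, which lies below `T` because
    -- `r < ℓ`, so the excepted position is not met.
    backward r 0<r r<ℓ with m≤n⇒∃[o]m+o≡n {ℓ} {T} (≤-cert 0 (+-mono-≤ ℓ+o≤1+T 0<o) (solve (T ∷ ℓ ∷ o ∷ [])))
    ... | q , ℓ+q≡T = trans
      (sym (sh (q + r) (T + r) (trans (shuffle q r ℓ) (cong (_+ r) ℓ+q≡T)) q+r≢T (m<m+n T 0<r)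
        (≤-cert o (+-mono-≤ r<ℓ T+ℓ+o≤e) (solve (T ∷ r ∷ ℓ ∷ o ∷ e ∷ [])))))
      (sh′ (q + r) (T + (r + o)) (trans (shuffle′ q r ℓ o) (cong (_+ (r + o)) ℓ+q≡T)) q+r≢T
        (≤-cert o 0<r (solve (T ∷ r ∷ o ∷ [])))
        (≤-cert 0 (+-mono-≤ r<ℓ T+ℓ+o≤e) (solve (T ∷ r ∷ ℓ ∷ o ∷ e ∷ []))))
      where
      shuffle : ∀ q r ℓ → q + r + ℓ ≡ ℓ + q + r
      shuffle = solve-∀
      shuffle′ : ∀ q r ℓ o → q + r + (ℓ + o) ≡ ℓ + q + (r + o)
      shuffle′ = solve-∀
      q+r<T : q + r < T
      q+r<T = ≤-cert 0 (+-mono-≤ r<ℓ (≤-reflexive ℓ+q≡T)) (solve (T ∷ q ∷ r ∷ ℓ ∷ []))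
      q+r≢T : q + r ≢ T
      q+r≢T = <⇒≢ q+r<T

  -- The period `s` holds for the unmodified word up to and including `e`. It refutes `Good₂`:
  -- either `s` is admissible, or `T + s` is `e` and the letters at `T` and `e` agree. In `Good₁`
  -- the minimal `ℓ` is at most `s`, and `m` then always carries the last letter to `X (e ∸ ℓ)`.
  periodic⇒¬Good : ∀ {X} s → 0 < s → s ≤ suc T → T + s ≤ e →
    (∀ i j → i + s ≡ j → T < j → j ≤ e → X i ≡ X j) → ¬ Good X
  periodic⇒¬Good {X} s 0<s s≤1+T T+s≤e per = bad
    where
    sh-s : Shifted X s
    sh-s i j eq _ T<j j<e = per i j eq T<j (<⇒≤ j<e)

    T<T+s : T < T + s
    T<T+s = m<m+n T 0<s

    T<e : T < e
    T<e = <-≤-trans T<T+s T+s≤e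

    XT : X T ≡ X (T + s)
    XT = per T (T + s) refl T<T+s T+s≤e

    Xe : X (e ∸ s) ≡ X e
    Xe = per (e ∸ s) e (m∸n+n≡m (≤-trans (m≤n+m s T) T+s≤e)) T<e ≤-refl

    bad : ¬ Good X
    bad (inj₂ (none , XT≢Xe)) with m≤n⇒m<n∨m≡n T+s≤e
    ... | inj₁ T+s<e = none s (0<s , s≤1+T , T+s<e) sh-s
    ... | inj₂ T+s≡e = XT≢Xe (trans XT (cong X T+s≡e))
    bad (inj₁ (ℓ , m , ((1≤ℓ , ℓ≤1+T , T+ℓ<e) , sh , min) , link , ne)) with <-cmp ℓ s
    ... | tri> _ _ s<ℓ = min s 0<s s<ℓ sh-s
    ... | tri≈ _ refl _ = ne (trans (+ᵈ-fixes m (X T) (X e) (trans link (sym XT))) (sym Xe))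
    ... | tri< ℓ<s _ _ with m≤n⇒∃[o]m+o≡n (<⇒≤ ℓ<s)
    ...   | o , refl = conclude (m≤n⇒m<n∨m≡n T+s≤e)
      where
      0<o : 0 < o
      0<o = ≤-cert 0 ℓ<s (solve (ℓ ∷ o ∷ []))

      X[T+ℓ]≡X[T+o] : X (T + ℓ) ≡ X (T + o)
      X[T+ℓ]≡X[T+o] = Shifted²⇒≡ ℓ o 1≤ℓ 0<o s≤1+T T+s≤e sh sh-s

      conclude : (T + (ℓ + o) < e) ⊎ (T + (ℓ + o) ≡ e) → ⊥
      conclude (inj₂ T+s≡e) = ne (begin
        X e +ᵈ m          ≡⟨ cong (λ z → X z +ᵈ m) T+s≡e ⟨
        X (T + (ℓ + o)) +ᵈ m    ≡⟨ cong (_+ᵈ m) XT ⟨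
        X T +ᵈ m          ≡⟨ link ⟩
        X (T + ℓ)         ≡⟨ X[T+ℓ]≡X[T+o] ⟩
        X (T + o)         ≡⟨ cong X (m+n∸n≡m (T + o) ℓ) ⟨
        X (T + o + ℓ ∸ ℓ) ≡⟨ cong (λ z → X (z ∸ ℓ)) (trans {j = T + (ℓ + o)} (solve (T ∷ o ∷ ℓ ∷ [])) T+s≡e) ⟩
        X (e ∸ ℓ)         ∎)
        where open ≡-Reasoning
      -- Now `X T` equals `X (T + ℓ)`, so `m` is zero and the period `ℓ` holds at `T` too. Moved
      -- left by `s`, the positions `e` and `e - ℓ` become `q + h + ℓ` and `q + h`, which are `ℓ`
      -- apart.
      conclude (inj₁ T+s<e) with m≤n⇒∃[o]m+o≡n T+s<e | m≤n⇒∃[o]m+o≡n ℓ≤1+T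
      ... | h , h-eq | q , q-eq = ne (begin
        X e +ᵈ m       ≡⟨ +ᵈ-fixes m (X T) (X e) (trans link (sym XT≡)) ⟩
        X e            ≡⟨ Xe′ ⟨
        X (q + h + ℓ)  ≡⟨ shift-by-ℓ (q + h ≟ T) ⟨
        X (q + h)      ≡⟨ per (q + h) (q + h + (ℓ + o)) refl
                            (≤-cert (h + o) (≤-reflexive (sym q-eq)) (solve (T ∷ ℓ ∷ o ∷ q ∷ h ∷ [])))
                            (≤-cert ℓ (+-mono-≤ (≤-reflexive q-eq) (≤-reflexive h-eq)) (solve (T ∷ ℓ ∷ o ∷ q ∷ h ∷ e ∷ []))) ⟩
        X (q + h + (ℓ + o))  ≡⟨ cong X (m+n∸n≡m (q + h + (ℓ + o)) ℓ) ⟨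
        X (q + h + (ℓ + o) + ℓ ∸ ℓ)  ≡⟨ cong (λ z → X (z ∸ ℓ)) (trans (shuffle q h ℓ o) (trans (cong (λ z → z + ℓ + h + o) q-eq) (trans (shuffle′ T h ℓ o) h-eq))) ⟩
        X (e ∸ ℓ)      ∎)
        where
        open ≡-Reasoning
        shuffle : ∀ q h ℓ o → q + h + (ℓ + o) + ℓ ≡ ℓ + q + ℓ + h + o
        shuffle = solve-∀
        shuffle′ : ∀ T h ℓ o → suc T + ℓ + h + o ≡ suc (T + (ℓ + o)) + h
        shuffle′ = solve-∀
        XT≡ : X T ≡ X (T + ℓ)
        XT≡ = trans XT (trans (sym (sh (T + o) (T + (ℓ + o)) (solve (T ∷ o ∷ ℓ ∷ [])) (>⇒≢ (m<m+n T 0<o)) T<T+s T+s<e))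
                        (sym X[T+ℓ]≡X[T+o]))
        q+h+ℓ≡1+T+h : q + h + ℓ ≡ suc T + h
        q+h+ℓ≡1+T+h = trans {j = ℓ + q + h} (solve (q ∷ h ∷ ℓ ∷ [])) (cong (_+ h) q-eq)
        Xe′ : X (q + h + ℓ) ≡ X e
        Xe′ = per (q + h + ℓ) e (trans (cong (_+ (ℓ + o)) q+h+ℓ≡1+T+h) (trans {j = suc (T + (ℓ + o)) + h} (solve (T ∷ h ∷ ℓ ∷ o ∷ [])) h-eq)) T<e ≤-refl
        shift-by-ℓ : Dec (q + h ≡ T) → X (q + h) ≡ X (q + h + ℓ)
        shift-by-ℓ (yes eq) = trans (cong X eq) (trans XT≡ (cong (λ z → X (z + ℓ)) (sym eq)))
        shift-by-ℓ (no ne′) = sh (q + h) (q + h + ℓ) refl ne′ (subst (T <_) (sym q+h+ℓ≡1+T+h) (m≤m+n (suc T) h))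
          (≤-cert 0 (+-mono-≤ (≤-reflexive h-eq) (+-mono-≤ (≤-reflexive q-eq) 0<s)) (solve (T ∷ ℓ ∷ o ∷ q ∷ h ∷ e ∷ [])))

  -- From `T - 1` on the word reads aaabab.... The pair at `T - 1` and `T + 1` allows `ℓ = 2`, and
  -- the letters at `T + 1` and `T + 2` exclude 1. Linking the `a` at `T` to the `b` at `T + 2`
  -- takes a nonzero `m`, while the letters at `e - 2` and `e` already agree, so shifting the last
  -- one breaks the period.
  alternating⇒Good : ∀ {X a b i₀} → suc i₀ ≡ T → T + 2 < e → a ≢ b →
    X i₀ ≡ a → X T ≡ a → X (1 + T) ≡ a → X (2 + T) ≡ b →
    (∀ i → T < i → 2 + i ≤ e → X i ≡ X (2 + i)) → Good X
  alternating⇒Good {X} {a} {b} {i₀} i₀-eq T+2<e a≢b Xi₀ XT X1+T X2+T alt with +ᵈ-solveʳ a b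
  ... | m , a+m≡b = inj₁ (2 , m , ((s≤s z≤n , s≤s (subst (1 ≤_) i₀-eq (s≤s z≤n)) , T+2<e) , sh , min)
      , trans (cong (_+ᵈ m) XT) (trans a+m≡b (sym (trans (cong X (+-comm T 2)) X2+T)))
      , λ eq → a≢b (trans (sym (+ᵈ-fixes m (X e) a (trans eq Xe))) a+m≡b))
    where
    2+T<e : 2 + T < e
    2+T<e = subst (_< e) (+-comm T 2) T+2<e

    Xe : X (e ∸ 2) ≡ X e
    Xe = trans (alt (e ∸ 2) (+-cancelˡ-< 2 T (e ∸ 2) (subst (2 + T <_) (sym eq) 2+T<e)) (≤-reflexive eq)) (cong X eq)
      where
      eq : 2 + (e ∸ 2) ≡ e
      eq = m+[n∸m]≡n (≤-trans (m≤m+n 2 T) (<⇒≤ 2+T<e))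

    sh : Shifted X 2
    sh i j refl i≢T T<i+2 i+2<e with <-cmp i T
    ... | tri≈ _ i≡T _ = contradiction i≡T i≢T
    ... | tri> _ _ T<i = trans (alt i T<i (subst (_≤ e) (+-comm i 2) (<⇒≤ i+2<e))) (cong X (+-comm 2 i))
    ... | tri< i<T _ _ with ≤-antisym (s≤s⁻¹ (subst (i <_) (sym i₀-eq) i<T))
                              (s≤s⁻¹ (s≤s⁻¹ (subst (suc (suc i₀) ≤_) (+-comm i 2) (subst (λ z → suc z ≤ i + 2) (sym i₀-eq) T<i+2))))
    ...   | refl = trans Xi₀ (trans (sym X1+T) (cong X (trans (cong suc (sym i₀-eq)) (+-comm 2 i))))

    min : ∀ k → 1 ≤ k → k < 2 → ¬ Shifted X k
    min (suc zero) _ _ sh₁ = a≢b (trans (sym X1+T) (trans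
      (sh₁ (1 + T) (2 + T) (+-comm (1 + T) 1) (>⇒≢ (n<1+n T)) (m<n+m T {2} z<s) 2+T<e) X2+T))
    min (suc (suc k)) _ (s≤s (s≤s ()))

  -- Periodicity of the shifted window.

  PeriodOn : ℕ → ℕ → ℕ → Word → Set
  PeriodOn k a b Y = 1 ≤ k × k + k + a ≤ b × (∀ i → a ≤ i → i + k < b → Y i ≡ Y (i + k))

  -- `Y` is the word shifted by `m` at `T`; `Z` is shifted at `e` as well, so its window through `e`
  -- is the concatenation with x_n + m. The window starts at `a`.
  module Window {X Y Z : Word} (m : Fin (suc D)) (T<e : T < e)
    (Y-T : Y T ≡ X T +ᵈ m) (Y-≢ : ∀ i → i < e → i ≢ T → Y i ≡ X i)
    (Z-e : Z e ≡ X e +ᵈ m) (Z-< : ∀ i → i < e → Z i ≡ Y i)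
    {a ℓ : ℕ} (a+ℓ : a + ℓ ≡ suc T) where

    1+T≤i+ℓ : ∀ {i} → a ≤ i → T < i + ℓ
    1+T≤i+ℓ a≤i = ≤-trans (≤-reflexive (sym a+ℓ)) (+-monoˡ-≤ ℓ a≤i)

    period⇒Shifted : ∀ {k} → k ≤ ℓ → PeriodOn k a e Y → Shifted X k
    period⇒Shifted {k} k≤ℓ (_ , _ , per) i j refl i≢T T<j j<e = trans
      (sym (Y-≢ i (≤-<-trans (m≤m+n i k) j<e) i≢T))
      (trans (per i (+-cancelʳ-≤ ℓ a i (≤-trans (≤-reflexive a+ℓ) (≤-trans T<j (+-monoʳ-≤ i k≤ℓ)))) j<e)
             (Y-≢ j j<e (>⇒≢ T<j)))

    period⇒Admissible : PeriodOn ℓ a e Y → Admissible ℓ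
    period⇒Admissible (1≤ℓ , 2ℓ+a≤e , _) = 1≤ℓ , ≤-trans (m≤n+m ℓ a) (≤-reflexive a+ℓ) ,
      ≤-cert 0 (+-mono-≤ 2ℓ+a≤e (≤-reflexive (sym a+ℓ))) (solve (T ∷ ℓ ∷ a ∷ e ∷ []))

    a≤T : 1 ≤ ℓ → a ≤ T
    a≤T 1≤ℓ = ≤-cert 0 (+-mono-≤ 1≤ℓ (≤-reflexive a+ℓ)) (solve (T ∷ ℓ ∷ a ∷ []))

    period⇒link : PeriodOn ℓ a e Y → X T +ᵈ m ≡ X (T + ℓ)
    period⇒link p@(1≤ℓ , _ , per) = let _ , _ , T+ℓ<e = period⇒Admissible p in
      trans (sym Y-T) (trans (per T (a≤T 1≤ℓ) T+ℓ<e) (Y-≢ (T + ℓ) T+ℓ<e (>⇒≢ (m<m+n T 1≤ℓ))))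

    link⇒period : Admissible ℓ → Shifted X ℓ → X T +ᵈ m ≡ X (T + ℓ) → PeriodOn ℓ a e Y
    link⇒period (1≤ℓ , _ , T+ℓ<e) sh link = 1≤ℓ
      , ≤-cert 0 (+-mono-≤ T+ℓ<e (≤-reflexive a+ℓ)) (solve (T ∷ ℓ ∷ a ∷ e ∷ []))
      , λ i a≤i i+ℓ<e → trans (left i i+ℓ<e (1+T≤i+ℓ a≤i) (i ≟ T))
                               (sym (Y-≢ (i + ℓ) i+ℓ<e (>⇒≢ (1+T≤i+ℓ a≤i))))
      where
      left : ∀ i → i + ℓ < e → T < i + ℓ → Dec (i ≡ T) → Y i ≡ X (i + ℓ)
      left i i+ℓ<e _ (yes refl) = trans Y-T link
      left i i+ℓ<e T<i+ℓ (no i≢T) = trans (Y-≢ i (≤-<-trans (m≤m+n i ℓ) i+ℓ<e) i≢T)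
        (sh i (i + ℓ) refl i≢T T<i+ℓ i+ℓ<e)

    -- Two kinds of pairs are beyond the reach of `Shifted X k`. For the pair starting at `T`,
    -- `Shifted²⇒≡` identifies the letters at `T + k` and `T + ℓ`. A pair ending at or before `T` is
    -- first moved right by `ℓ`, past `T`.
    Shifted⇒period : ∀ {k} → 1 ≤ k → k < ℓ → PeriodOn ℓ a e Y → Shifted X k → PeriodOn k a e Y
    Shifted⇒period {k} 1≤k k<ℓ p@(1≤ℓ , 2ℓ+a≤e , per) sh = 1≤k
      , ≤-trans (+-monoˡ-≤ a (+-mono-≤ (<⇒≤ k<ℓ) (<⇒≤ k<ℓ))) 2ℓ+a≤e
      , λ i a≤i i+k<e → main i a≤i i+k<e (T <? i + k) (i ≟ T)
      where
      adm = period⇒Admissible p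
      T+ℓ<e = proj₂ (proj₂ adm)

      XT+k : X (T + k) ≡ X (T + ℓ)
      XT+k with m≤n⇒∃[o]m+o≡n (<⇒≤ k<ℓ)
      ... | o , refl = trans
        (Shifted²⇒≡ k o 1≤k 0<o (proj₁ (proj₂ adm)) (<⇒≤ T+ℓ<e) sh (period⇒Shifted ≤-refl p))
        (sh (T + o) (T + (k + o)) (solve (T ∷ k ∷ o ∷ [])) (>⇒≢ (m<m+n T 0<o)) (m<m+n T 1≤ℓ) T+ℓ<e)
        where
        0<o : 0 < o
        0<o = ≤-cert 0 k<ℓ (solve (k ∷ o ∷ []))

      main : ∀ i → a ≤ i → i + k < e → Dec (T < i + k) → Dec (i ≡ T) → Y i ≡ Y (i + k)
      main i a≤i i+k<e (yes T<i+k) (yes refl) = trans (per T a≤i T+ℓ<e)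
        (trans (Y-≢ (T + ℓ) T+ℓ<e (>⇒≢ (m<m+n T 1≤ℓ)))
        (trans (sym XT+k) (sym (Y-≢ (T + k) i+k<e (>⇒≢ T<i+k)))))
      main i a≤i i+k<e (yes T<i+k) (no i≢T) = trans (Y-≢ i (≤-<-trans (m≤m+n i k) i+k<e) i≢T)
        (trans (sh i (i + k) refl i≢T T<i+k i+k<e) (sym (Y-≢ (i + k) i+k<e (>⇒≢ T<i+k))))
      main i a≤i i+k<e (no T≮i+k) _ = begin
        Y i            ≡⟨ per i a≤i i+ℓ<e ⟩
        Y (i + ℓ)      ≡⟨ Y-≢ (i + ℓ) i+ℓ<e (>⇒≢ T<i+ℓ) ⟩
        X (i + ℓ)      ≡⟨ sh (i + ℓ) (i + k + ℓ) (solve (i ∷ k ∷ ℓ ∷ [])) (>⇒≢ T<i+ℓ) T<i+k+ℓ i+k+ℓ<e ⟩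
        X (i + k + ℓ)  ≡⟨ Y-≢ (i + k + ℓ) i+k+ℓ<e (>⇒≢ T<i+k+ℓ) ⟨
        Y (i + k + ℓ)  ≡⟨ per (i + k) (≤-trans a≤i (m≤m+n i k)) i+k+ℓ<e ⟨
        Y (i + k)      ∎
        where
        open ≡-Reasoning
        T<i+ℓ = 1+T≤i+ℓ a≤i
        T<i+k+ℓ = 1+T≤i+ℓ (≤-trans a≤i (m≤m+n i k))
        i+k+ℓ<e = ≤-<-trans (+-monoˡ-≤ ℓ (≮⇒≥ T≮i+k)) T+ℓ<e
        i+ℓ<e = ≤-<-trans (+-monoˡ-≤ ℓ (m≤m+n i k)) i+k+ℓ<e

    shorten : ∀ {k} → k < ℓ → PeriodOn ℓ a e Y → PeriodOn k a (suc e) Z → PeriodOn k a e Y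
    shorten {k} k<ℓ (_ , 2ℓ+a≤e , _) (1≤k , _ , per) = 1≤k
      , ≤-trans (+-monoˡ-≤ a (+-mono-≤ (<⇒≤ k<ℓ) (<⇒≤ k<ℓ))) 2ℓ+a≤e
      , λ i a≤i i+k<e → trans (sym (Z-< i (≤-<-trans (m≤m+n i k) i+k<e)))
                         (trans (per i a≤i (m≤n⇒m≤1+n i+k<e)) (Z-< (i + k) i+k<e))

    module _ (p : PeriodOn ℓ a e Y) where
      private
        1≤ℓ = proj₁ p
        2ℓ+a≤e = proj₁ (proj₂ p)
        per = proj₂ (proj₂ p)
        T+ℓ<e = proj₂ (proj₂ (period⇒Admissible p))
        ℓ≤e = ≤-trans (m≤n+m ℓ T) (<⇒≤ T+ℓ<e)
        e∸ℓ+ℓ = m∸n+n≡m ℓ≤e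
        e∸ℓ<e = ∸-monoʳ-< 1≤ℓ ℓ≤e

        T<e∸ℓ : T < e ∸ ℓ
        T<e∸ℓ = subst (_< e ∸ ℓ) (m+n∸n≡m T ℓ) (∸-monoˡ-< T+ℓ<e (m≤n+m ℓ T))

        Z[e∸ℓ] : Z (e ∸ ℓ) ≡ X (e ∸ ℓ)
        Z[e∸ℓ] = trans (Z-< (e ∸ ℓ) e∸ℓ<e) (Y-≢ (e ∸ ℓ) e∸ℓ<e (>⇒≢ T<e∸ℓ))

      extended⇒≡ : PeriodOn ℓ a (suc e) Z → X e +ᵈ m ≡ X (e ∸ ℓ)
      extended⇒≡ (_ , _ , perZ) = begin
        X e +ᵈ m         ≡⟨ Z-e ⟨
        Z e              ≡⟨ cong Z e∸ℓ+ℓ ⟨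
        Z (e ∸ ℓ + ℓ)    ≡⟨ perZ (e ∸ ℓ) (≤-trans (a≤T 1≤ℓ) (<⇒≤ T<e∸ℓ)) (s≤s (≤-reflexive e∸ℓ+ℓ)) ⟨
        Z (e ∸ ℓ)        ≡⟨ Z[e∸ℓ] ⟩
        X (e ∸ ℓ)        ∎
        where open ≡-Reasoning

      ≡⇒extended : X e +ᵈ m ≡ X (e ∸ ℓ) → PeriodOn ℓ a (suc e) Z
      ≡⇒extended eq = 1≤ℓ , m≤n⇒m≤1+n 2ℓ+a≤e , λ i a≤i i+ℓ≤e → main i a≤i (m≤n⇒m<n∨m≡n (s≤s⁻¹ i+ℓ≤e))
        where
        main : ∀ i → a ≤ i → i + ℓ < e ⊎ i + ℓ ≡ e → Z i ≡ Z (i + ℓ)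
        main i a≤i (inj₁ i+ℓ<e) = trans (Z-< i (≤-<-trans (m≤m+n i ℓ) i+ℓ<e))
          (trans (per i a≤i i+ℓ<e) (sym (Z-< (i + ℓ) i+ℓ<e)))
        main i a≤i (inj₂ i+ℓ≡e) = begin
          Z i              ≡⟨ cong Z (trans (sym (m+n∸n≡m i ℓ)) (cong (_∸ ℓ) i+ℓ≡e)) ⟩
          Z (e ∸ ℓ)        ≡⟨ Z[e∸ℓ] ⟩
          X (e ∸ ℓ)        ≡⟨ eq ⟨
          X e +ᵈ m         ≡⟨ Z-e ⟨
          Z e              ≡⟨ cong Z i+ℓ≡e ⟨
          Z (i + ℓ)        ∎
          where open ≡-Reasoning

-- Letters of lists, strings and substrings.

module _ {A : Set} where

  letter-take : ∀ k (xs : List A) {i} → i < k → letter (L.take k xs) (suc i) ≡ letter xs (suc i)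
  letter-take (suc k) []       _ = refl
  letter-take (suc k) (x ∷ xs) {zero}  _ = refl
  letter-take (suc k) (x ∷ xs) {suc i} (s≤s i<k) = letter-take k xs i<k

  letter-drop : ∀ k (xs : List A) i → letter (L.drop k xs) (suc i) ≡ letter xs (suc (k + i))
  letter-drop zero    xs       i = refl
  letter-drop (suc k) []       i = refl
  letter-drop (suc k) (x ∷ xs) i = letter-drop k xs i

  letter-++ˡ : ∀ (xs ys : List A) {i} → i < length xs → letter (xs L.++ ys) (suc i) ≡ letter xs (suc i)
  letter-++ˡ (x ∷ xs) ys {zero}  _ = refl
  letter-++ˡ (x ∷ xs) ys {suc i} (s≤s i<n) = letter-++ˡ xs ys i<n

  letter-last : ∀ (xs : List A) c → letter (xs L.++ c ∷ []) (suc (length xs)) ≡ just c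
  letter-last []       c = refl
  letter-last (x ∷ xs) c = letter-last xs c

module _ {D : ℕ} where

  private A = Fin (suc D)

  -- Positions past the end read `zero`, which makes a string a total `Word`. Indices start at 0,
  -- those of `letter` at 1.
  at : ∀ {n} → Vec A n → ℕ → A
  at V.[]       _       = zero
  at (x V.∷ xs) zero    = x
  at (x V.∷ xs) (suc i) = at xs i

  at-ext : ∀ {n} (x y : Vec A n) → (∀ i → i < n → at x i ≡ at y i) → x ≡ y
  at-ext V.[]       V.[]       _ = refl
  at-ext (x V.∷ xs) (y V.∷ ys) f = cong₂ V._∷_ (f 0 z<s) (at-ext xs ys λ i i<n → f (suc i) (s≤s i<n))

  letter-at : ∀ {n} (x : Vec A n) {i} → i < n → letter (toList x) (suc i) ≡ just (at x i)
  letter-at (x V.∷ xs) {zero}  _ = refl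
  letter-at (x V.∷ xs) {suc i} (s≤s i<n) = letter-at xs i<n

  at-upd : ∀ {n} (x : Vec A n) i m → i < n → at (upd x (suc i) m) i ≡ at x i +ᵈ m
  at-upd (x V.∷ xs) zero    m _ = refl
  at-upd (x V.∷ xs) (suc i) m (s≤s i<n) = at-upd xs i m i<n

  at-upd-≢ : ∀ {n} (x : Vec A n) i j m → j ≢ i → at (upd x (suc i) m) j ≡ at x j
  at-upd-≢ V.[]       i       j       m _ = refl
  at-upd-≢ (x V.∷ xs) zero    zero    m j≢i = contradiction refl j≢i
  at-upd-≢ (x V.∷ xs) zero    (suc j) m _ = refl
  at-upd-≢ (x V.∷ xs) (suc i) zero    m _ = refl
  at-upd-≢ (x V.∷ xs) (suc i) (suc j) m j≢i = at-upd-≢ xs i j m (j≢i ∘ cong suc)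

  at-∷ʳ-< : ∀ {n} (x : Vec A n) c {i} → i < n → at (x ∷ʳ c) i ≡ at x i
  at-∷ʳ-< (x V.∷ xs) c {zero}  _ = refl
  at-∷ʳ-< (x V.∷ xs) c {suc i} (s≤s i<n) = at-∷ʳ-< xs c i<n

  at-∷ʳ-last : ∀ {n} (x : Vec A n) c → at (x ∷ʳ c) n ≡ c
  at-∷ʳ-last V.[]       c = refl
  at-∷ʳ-last (x V.∷ xs) c = at-∷ʳ-last xs c

  spell : ∀ n → (ℕ → A) → Vec A n
  spell zero    f = V.[]
  spell (suc n) f = f 0 V.∷ spell n (f ∘ suc)

  at-spell : ∀ n f {i} → i < n → at (spell n f) i ≡ f i
  at-spell (suc n) f {zero}  _ = refl
  at-spell (suc n) f {suc i} (s≤s i<n) = at-spell n (f ∘ suc) i<n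

  -- The second word is not shifted into place: it restarts from its own index 0 after `k` letters.
  splice : ℕ → (ℕ → A) → (ℕ → A) → ℕ → A
  splice zero    F G i       = G i
  splice (suc k) F G zero    = F zero
  splice (suc k) F G (suc i) = splice k (F ∘ suc) G i

  splice-< : ∀ k F G {i} → i < k → splice k F G i ≡ F i
  splice-< (suc k) F G {zero}  _ = refl
  splice-< (suc k) F G {suc i} (s≤s i<k) = splice-< k (F ∘ suc) G i<k

  splice-+ : ∀ k F G i → splice k F G (k + i) ≡ G i
  splice-+ zero    F G i = refl
  splice-+ (suc k) F G i = splice-+ k (F ∘ suc) G i

  Spells : List A → ℕ → ℕ → (ℕ → A) → Set
  Spells w a b Y = length w + a ≡ b × (∀ i → i < length w → letter w (suc i) ≡ just (Y (i + a)))

  sub-spells : ∀ {n} (x : Vec A n) a b → a ≤ b → b ≤ n → Spells (sub x (suc a) b) a b (at x)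
  sub-spells {n} x a b a≤b b≤n = trans (cong (_+ a) len) (m∸n+n≡m a≤b) , λ i i<len →
    let i<b∸a = subst (i <_) len i<len in
    trans (letter-take (b ∸ a) (L.drop a (toList x)) i<b∸a)
    (trans (letter-drop a (toList x) i)
    (trans (letter-at x (<-≤-trans (subst (a + i <_) (m+[n∸m]≡n a≤b) (+-monoʳ-< a i<b∸a)) b≤n))
    (cong (just ∘ at x) (+-comm a i))))
    where
    len : length (sub x (suc a) b) ≡ b ∸ a
    len = trans (length-take (b ∸ a) (L.drop a (toList x)))
      (trans (cong ((b ∸ a) ⊓_) (trans (length-drop a (toList x)) (cong (_∸ a) (Vec.length-toList x))))
             (m≤n⇒m⊓n≡m (∸-monoˡ-≤ a b≤n)))

  ++-spells : ∀ {w a b Y Z c} → Spells w a b Y → (∀ i → i < b → Z i ≡ Y i) → Z b ≡ c →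
    Spells (w L.++ c ∷ []) a (suc b) Z
  ++-spells {w} {a} {b} {Y} {Z} {c} (len , letters) Z≡Y Zb≡c =
    trans (cong (_+ a) length-w++c) (cong suc len) ,
    λ i i<len → main i (m≤n⇒m<n∨m≡n (s≤s⁻¹ (subst (i <_) length-w++c i<len)))
    where
    length-w++c : length (w L.++ c ∷ []) ≡ suc (length w)
    length-w++c = trans (length-++ w) (+-comm (length w) 1)
    main : ∀ i → i < length w ⊎ i ≡ length w → letter (w L.++ c ∷ []) (suc i) ≡ just (Z (i + a))
    main i (inj₁ i<len) = trans (letter-++ˡ w (c ∷ []) i<len)
      (trans (letters i i<len) (cong just (sym (Z≡Y (i + a) (<-≤-trans (+-monoˡ-< a i<len) (≤-reflexive len))))))
    main i (inj₂ refl) = trans (letter-last w c) (cong just (trans (sym Zb≡c) (cong Z (sym len))))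

  module _ {T e : ℕ} where
    open Letters {D} T e using (PeriodOn)

    HasPeriod⇔PeriodOn : ∀ {k w a b Y} → Spells w a b Y → HasPeriod k w ⇔ PeriodOn k a b Y
    HasPeriod⇔PeriodOn {k} {w} {a} {b} {Y} (len , letters) = mk⇔ to from
      where
      to : HasPeriod k w → PeriodOn k a b Y
      to (1≤k , 2k≤len , per) = 1≤k , ≤-trans (+-monoˡ-≤ a 2k≤len) (≤-reflexive len) , λ i a≤i i+k<b →
        main i a≤i i+k<b (m∸n+n≡m a≤i)
        where
        main : ∀ i → a ≤ i → i + k < b → i ∸ a + a ≡ i → Y i ≡ Y (i + k)
        main i a≤i i+k<b eq = just-injective (begin
          just (Y i)                        ≡⟨ cong (just ∘ Y) eq ⟨
          just (Y (i ∸ a + a))              ≡⟨ letters (i ∸ a) (≤-<-trans (m≤m+n (i ∸ a) k) i∸a+k<len) ⟨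
          letter w (suc (i ∸ a))            ≡⟨ per (suc (i ∸ a)) z<s (m+n≤o⇒m≤o∸n (suc (i ∸ a)) i∸a+k<len) ⟩
          letter w (suc (i ∸ a + k))        ≡⟨ letters (i ∸ a + k) i∸a+k<len ⟩
          just (Y (i ∸ a + k + a))          ≡⟨ cong (just ∘ Y) i∸a+k+a ⟩
          just (Y (i + k))                  ∎)
          where
          open ≡-Reasoning
          i∸a+k+a : i ∸ a + k + a ≡ i + k
          i∸a+k+a = trans (+-assoc (i ∸ a) k a) (trans (cong (i ∸ a +_) (+-comm k a))
            (trans (sym (+-assoc (i ∸ a) a k)) (cong (_+ k) eq)))
          i∸a+k<len : i ∸ a + k < length w
          i∸a+k<len = +-cancelʳ-< a (i ∸ a + k) (length w)
            (subst₂ _<_ (sym i∸a+k+a) (sym len) i+k<b)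

      from : PeriodOn k a b Y → HasPeriod k w
      from (1≤k , 2k+a≤b , per) = 1≤k , 2k≤len , main
        where
        2k≤len : k + k ≤ length w
        2k≤len = +-cancelʳ-≤ a (k + k) (length w) (≤-trans 2k+a≤b (≤-reflexive (sym len)))
        main : ∀ i → 1 ≤ i → i ≤ length w ∸ k → letter w i ≡ letter w (i + k)
        main (suc i) _ i<len∸k = begin
          letter w (suc i)        ≡⟨ letters i (≤-<-trans (m≤m+n i k) i+k<len) ⟩
          just (Y (i + a))        ≡⟨ cong just (per (i + a) (m≤n+m a i)
                                      (subst₂ _<_ (sym (i+a+k i a k)) len (+-monoˡ-< a i+k<len))) ⟩
          just (Y (i + a + k))    ≡⟨ cong (just ∘ Y) (i+a+k i a k) ⟩
          just (Y (i + k + a))    ≡⟨ letters (i + k) i+k<len ⟨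
          letter w (suc (i + k))  ∎
          where
          open ≡-Reasoning
          i+a+k : ∀ i a k → i + a + k ≡ i + k + a
          i+a+k = solve-∀
          i+k<len : i + k < length w
          i+k<len = m≤o∸n⇒m+n≤o (suc i) (≤-trans (m≤m+n k k) 2k≤len) i<len∸k

  -- Membership in the two defining sets of the code.

  module Membership (T e : ℕ) (T<e : T < e) where
    open Letters {D} T e
    open Equivalence

    module _ (x : Vec A (suc e)) where
      private
        X = at x

      module Unfold (m : A) (ℓ : ℕ) (1≤ℓ : 1 ≤ ℓ) (ℓ≤1+T : ℓ ≤ suc T) where
        y = upd x (suc T) m
        -- With both positions shifted in one string, the concatenation becomes a contiguous range
        -- of letters of `z`.
        z = upd y (suc e) m
        w = sub y (suc (suc T) ∸ ℓ) e
        a = suc T ∸ ℓ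

        open Window {X} {at y} {at z} m T<e (at-upd x T m (m≤n⇒m≤1+n T<e))
          (λ i _ i≢T → at-upd-≢ x T i m i≢T)
          (trans (at-upd y e m ≤-refl) (cong (_+ᵈ m) (at-upd-≢ x T e m (>⇒≢ T<e))))
          (λ i i<e → at-upd-≢ y e i m (<⇒≢ i<e))
          {a} {ℓ} (m∸n+n≡m ℓ≤1+T) public

        w-spells : Spells w a e (at y)
        w-spells rewrite +-∸-assoc 1 ℓ≤1+T =
          sub-spells y a e (≤-trans (m∸n≤m (suc T) ℓ) T<e) (n≤1+n e)

        w⁺ = w L.++ L.map (_+ᵈ m) (sub x (suc e) (suc e))

        w⁺-spells : Spells w⁺ a (suc e) (at z)
        w⁺-spells = subst (λ s → Spells (w L.++ s) a (suc e) (at z)) (sym (last-letter x))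
          (++-spells {w = w} {c = at x e +ᵈ m} w-spells (λ i i<e → at-upd-≢ y e i m (<⇒≢ i<e))
            (trans (at-upd y e m ≤-refl) (cong (_+ᵈ m) (at-upd-≢ x T e m (>⇒≢ T<e)))))
          where
          last-letter : ∀ {e} (x : Vec A (suc e)) → L.map (_+ᵈ m) (sub x (suc e) (suc e)) ≡ (at x e +ᵈ m) ∷ []
          last-letter {e} x rewrite +-∸-assoc 1 (≤-refl {e}) | n∸n≡0 e = go x
            where
            go : ∀ {e} (x : Vec A (suc e)) → L.map (_+ᵈ m) (L.take 1 (L.drop e (toList x))) ≡ (at x e +ᵈ m) ∷ []
            go {zero}  (c V.∷ V.[]) = refl
            go {suc e} (c V.∷ x)    = go x

        w⇔ : ∀ {k} → HasPeriod k w ⇔ PeriodOn k a e (at y)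
        w⇔ = HasPeriod⇔PeriodOn {T} {e} {w = w} w-spells

        w⁺⇔ : ∀ {k} → HasPeriod k w⁺ ⇔ PeriodOn k a (suc e) (at z)
        w⁺⇔ = HasPeriod⇔PeriodOn {T} {e} {w = w⁺} w⁺-spells

        -- The two notions of minimality agree: a shorter period of the window is `Shifted`, and in
        -- the presence of the period `ℓ` a shorter `Shifted` period is one of the window.
        Periodic⇔ : Periodic ℓ w ⇔ (Minimal X ℓ × X T +ᵈ m ≡ X (T + ℓ))
        Periodic⇔ = mk⇔
          (λ (hp , min) → let p = to w⇔ hp in
            (period⇒Admissible p , period⇒Shifted ≤-refl p , λ k 1≤k k<ℓ shk →
              min k k<ℓ (from w⇔ (Shifted⇒period 1≤k k<ℓ p shk))) , period⇒link p)
          (λ ((adm , sh , min) , link) → from w⇔ (link⇒period adm sh link) , λ k k<ℓ hpk →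
            min k (proj₁ hpk) k<ℓ (period⇒Shifted (<⇒≤ k<ℓ) (to w⇔ hpk)))

        -- Only the pair `(e - ℓ, e)` is new. Minimality is inherited, since a shorter period of the
        -- extended window restricts to `w`.
        Periodic⁺⇔ : Periodic ℓ w → Periodic ℓ w⁺ ⇔ (X e +ᵈ m ≡ X (e ∸ ℓ))
        Periodic⁺⇔ (hp , min) = mk⇔
          (λ (hp⁺ , _) → extended⇒≡ (to w⇔ hp) (to w⁺⇔ hp⁺))
          (λ eq → from w⁺⇔ (≡⇒extended (to w⇔ hp) eq) , λ k k<ℓ hpk →
            min k k<ℓ (from w⇔ (shorten k<ℓ (to w⇔ hp) (to w⁺⇔ hpk))))

      open Unfold using (Periodic⇔; Periodic⁺⇔)

      InS⇔Good : InS (suc T) x ⇔ Good X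
      InS⇔Good = mk⇔ ⇒ ⇐
        where
        ⇒ : InS (suc T) x → Good X
        ⇒ (inS₁ (m , ℓ , 1≤ℓ , ℓ≤1+T , per , ¬per⁺)) =
          let min , link = to (Periodic⇔ m ℓ 1≤ℓ ℓ≤1+T) per in
          inj₁ (ℓ , m , min , link , ¬per⁺ ∘ from (Periodic⁺⇔ m ℓ 1≤ℓ ℓ≤1+T per))
        ⇒ (inS₂ (ne , none)) = inj₂ (none′ , λ eq → ne
          (trans (letter-at x (m≤n⇒m≤1+n T<e)) (trans (cong just eq) (sym (letter-at x ≤-refl)))))
          where
          none′ : ∀ ℓ → Admissible ℓ → ¬ Shifted X ℓ
          none′ with classify X
          ... | inj₂ n = n
          ... | inj₁ (ℓ , min@((1≤ℓ , ℓ≤1+T , _) , _)) =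
            let m , link = +ᵈ-solveʳ (X T) (X (T + ℓ)) in
            contradiction (from (Periodic⇔ m ℓ 1≤ℓ ℓ≤1+T) (min , link)) (none m ℓ 1≤ℓ ℓ≤1+T)
        ⇐ : Good X → InS (suc T) x
        ⇐ (inj₁ (ℓ , m , min@((1≤ℓ , ℓ≤1+T , _) , _) , link , ne)) =
          let per = from (Periodic⇔ m ℓ 1≤ℓ ℓ≤1+T) (min , link) in
          inS₁ (m , ℓ , 1≤ℓ , ℓ≤1+T , per , ne ∘ to (Periodic⁺⇔ m ℓ 1≤ℓ ℓ≤1+T per))
        ⇐ (inj₂ (none , ne)) = inS₂
          ( (λ eq → ne (just-injective (trans (sym (letter-at x (m≤n⇒m≤1+n T<e))) (trans eq (letter-at x ≤-refl)))))
          , λ m ℓ 1≤ℓ ℓ≤1+T per → let (adm , sh , _) , _ = to (Periodic⇔ m ℓ 1≤ℓ ℓ≤1+T) per in none ℓ adm sh)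

-- Walks in the de Bruijn graph as shifts.

module _ {D e : ℕ} where

  private S = Str (suc D) (suc e)

  -- A walk of length `k` drops the first `k` letters and appends `k` arbitrary ones, so it exists
  -- exactly if the remaining letters of `w` begin `v`. From `k = n` on the condition is empty.
  ShiftBy : ℕ → S → S → Set
  ShiftBy k w v = ∀ i → i + k < suc e → at w (i + k) ≡ at v i

  tail⇒take : ∀ {n} (xs : Str (suc D) n) (ys : Str (suc D) (suc n)) →
    (∀ i → i < n → at xs i ≡ at ys i) → toList xs ≡ L.take n (toList ys)
  tail⇒take V.[]       ys       _ = refl
  tail⇒take (x V.∷ xs) (y V.∷ ys) f = cong₂ _∷_ (f 0 z<s) (tail⇒take xs ys λ i i<n → f (suc i) (s≤s i<n))

  Arc⇔ShiftBy : ∀ (x y : S) → Arc x y ⇔ ShiftBy 1 x y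
  Arc⇔ShiftBy (x V.∷ xs) y = mk⇔ to from
    where
    to : toList xs ≡ L.take e (toList y) → ShiftBy 1 (x V.∷ xs) y
    to arc i i+1<n rewrite +-comm i 1 = just-injective (begin
      just (at xs i)                           ≡⟨ letter-at xs i<e ⟨
      letter (toList xs) (suc i)               ≡⟨ cong (λ l → letter l (suc i)) arc ⟩
      letter (L.take e (toList y)) (suc i)     ≡⟨ letter-take e (toList y) i<e ⟩
      letter (toList y) (suc i)                ≡⟨ letter-at y (m≤n⇒m≤1+n i<e) ⟩
      just (at y i)                            ∎)
      where
      open ≡-Reasoning
      i<e = s≤s⁻¹ i+1<n
    from : ShiftBy 1 (x V.∷ xs) y → toList xs ≡ L.take e (toList y)
    from sh = tail⇒take xs y λ i i<e →
      subst (λ j → at (x V.∷ xs) j ≡ at y i) (+-comm i 1) (sh i (subst (_< suc e) (+-comm 1 i) (s≤s i<e)))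

  Walk⇒ShiftBy : ∀ {k} {w v : S} → Walk k w v → ShiftBy k w v
  Walk⇒ShiftBy {w = w} here i _ = cong (at w) (+-identityʳ i)
  Walk⇒ShiftBy {suc k} {w} (step {w = w′} arc walk) i i+1+k<n =
    trans (cong (at w) (trans (+-suc i k) (+-comm 1 (i + k))))
    (trans (Equivalence.to (Arc⇔ShiftBy w w′) arc (i + k) (subst (_< suc e) (trans (+-suc i k) (+-comm 1 (i + k))) i+1+k<n))
      (Walk⇒ShiftBy walk i (<-trans (+-monoʳ-< i ≤-refl) i+1+k<n)))

  ShiftBy⇒Walk : ∀ k {w v : S} → ShiftBy k w v → Walk k w v
  ShiftBy⇒Walk zero {w} {v} sh with at-ext w v (λ i i<n →
    trans (cong (at w) (sym (+-identityʳ i))) (sh i (subst (_< suc e) (sym (+-identityʳ i)) i<n)))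
  ... | refl = here
  ShiftBy⇒Walk (suc k) {w} {v} sh = step (Equivalence.from (Arc⇔ShiftBy w w′) first) (ShiftBy⇒Walk k {w′} {v} rest)
    where
    next : ℕ → Fin (suc D)
    -- The appended letter stands at position `e` and reaches position `e - k` of `v` after the
    -- remaining `k` steps. For `k > e` the truncated subtraction picks an arbitrary letter.
    next = splice e (at w ∘ suc) (λ _ → at v (e ∸ k))
    w′ : S
    w′ = spell (suc e) next
    first : ShiftBy 1 w w′
    first i i+1<n rewrite +-comm i 1 =
      sym (trans (at-spell (suc e) next (<⇒≤ i+1<n)) (splice-< e _ _ (s≤s⁻¹ i+1<n)))
    rest : ShiftBy k w′ v
    rest i i+k<n = trans (at-spell (suc e) next i+k<n) (main (m≤n⇒m<n∨m≡n (s≤s⁻¹ i+k<n)))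
      where
      main : i + k < e ⊎ i + k ≡ e → next (i + k) ≡ at v i
      main (inj₁ i+k<e) = trans (splice-< e _ _ i+k<e) (trans (cong (at w) (sym (+-suc i k)))
        (sh i (subst (_< suc e) (sym (+-suc i k)) (s≤s i+k<e))))
      main (inj₂ i+k≡e) = trans (cong next (trans i+k≡e (sym (+-identityʳ e))))
        (trans (splice-+ e _ _ 0) (cong (at v) (trans (cong (_∸ k) (sym i+k≡e)) (m+n∸n≡m i k))))

  InBall⇔ : ∀ {t} (w v : S) → InBall t w v ⇔ (∃ λ k → k ≤ t × ShiftBy k w v)
  InBall⇔ w v = mk⇔ (λ (k , k≤t , walk) → k , k≤t , Walk⇒ShiftBy walk)
                 (λ (k , k≤t , sh) → k , k≤t , ShiftBy⇒Walk k {w} {v} sh)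

  -- The final arc of a nonempty walk appends the last letter of its endpoint freely, so the walk
  -- can be redirected to the sibling; only the empty walk cannot.
  sibling-ball : ∀ {t} {w u v : S} → (∀ i → i < e → at u i ≡ at v i) → w ≢ u → InBall t w u → InBall t w v
  sibling-ball u≡v w≢u (zero , _ , here) = contradiction refl w≢u
  sibling-ball u≡v w≢u (suc k , k≤t , walk) = suc k , k≤t , ShiftBy⇒Walk (suc k) λ i i+k<n →
    trans (Walk⇒ShiftBy walk i i+k<n) (u≡v i (<-≤-trans (m<m+n i z<s) (s≤s⁻¹ i+k<n)))

-- The identifying property.

other : ∀ {D} (a : Fin (suc (suc D))) → ∃ λ b → b ≢ a
other zero    = suc zero , λ ()
other (suc a) = zero , λ ()

module Code {D : ℕ} (T e : ℕ) (0<T : 0 < T) (1+2T≤e : suc (T + T) ≤ e) (T+2<e : T + 2 < e) where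

  open Letters {suc D} T e
  open Equivalence

  private
    A = Fin (suc (suc D))
    S = Str (suc (suc D)) (suc e)

    T<e : T < e
    T<e = ≤-trans (s≤s (m≤m+n T T)) 1+2T≤e

  Good-last : ∀ X Y → (∀ i → i < e → X i ≡ Y i) → X e ≢ Y e → Good X ⊎ Good Y
  Good-last X Y X≡Y Xe≢Ye with forbidden-last T<e X
  ... | β , f with X e Fin.≟ β
  ...   | yes Xe≡β = inj₂ (from (f Y X≡Y) λ Ye≡β → Xe≢Ye (trans Xe≡β (sym Ye≡β)))
  ...   | no Xe≢β = inj₁ (from (f X λ _ _ → refl) Xe≢β)

  Good-at-T : ∀ X Y → (∀ i → i ≤ e → i ≢ T → X i ≡ Y i) → X T ≢ Y T → Good X ⊎ Good Y
  Good-at-T X Y X≡Y XT≢YT with forbidden-at-T T<e X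
  ... | β , f with X T Fin.≟ β
  ...   | yes XT≡β = inj₂ (from (f Y X≡Y) λ YT≡β → XT≢YT (trans XT≡β (sym YT≡β)))
  ...   | no XT≢β = inj₁ (from (f X λ _ _ _ → refl) XT≢β)

  -- Words are functions, so agreement up to `e` is not equality; `forbidden-last` already speaks of
  -- every word with the same letters below `e`.
  Good-resp : ∀ {X Y} → (∀ i → i ≤ e → X i ≡ Y i) → Good X → Good Y
  Good-resp {X} {Y} X≡Y good with forbidden-last T<e X
  ... | β , f = from (f Y λ i i<e → X≡Y i (<⇒≤ i<e)) λ Ye≡β →
    to (f X λ _ _ → refl) good (trans (X≡Y e ≤-refl) Ye≡β)

  -- The word b...bcU with `c` at position `T`: `U` is reached after `T + 1` steps, and `c` is the
  -- letter that `Good-at-T` varies.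
  prefixed : A → A → Word → Word
  prefixed b c U = splice T (λ _ → b) (splice 1 (λ _ → c) U)

  prefixed-< : ∀ b c U {i} → i < T → prefixed b c U i ≡ b
  prefixed-< b c U = splice-< T _ _

  prefixed-T : ∀ b c U → prefixed b c U T ≡ c
  prefixed-T b c U = trans (cong (prefixed b c U) (sym (+-identityʳ T))) (splice-+ T _ _ 0)

  prefixed-> : ∀ b c U i → prefixed b c U (suc T + i) ≡ U i
  prefixed-> b c U i = trans (cong (prefixed b c U) (sym (+-suc T i))) (splice-+ T _ _ (suc i))

  prefixed-≢T : ∀ b c c′ U i → i ≢ T → prefixed b c U i ≡ prefixed b c′ U i
  prefixed-≢T b c c′ U i i≢T with <-cmp i T
  ... | tri< i<T _ _ = trans (prefixed-< b c U i<T) (sym (prefixed-< b c′ U i<T))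
  ... | tri≈ _ i≡T _ = contradiction i≡T i≢T
  ... | tri> _ _ T<i with m≤n⇒∃[o]m+o≡n T<i
  ...   | o , refl = trans (prefixed-> b c U o) (sym (prefixed-> b c′ U o))

  Good-prefixed : ∀ b c c′ U → c ≢ c′ → Good (prefixed b c U) ⊎ Good (prefixed b c′ U)
  Good-prefixed b c c′ U c≢c′ = Good-at-T _ _ (λ i _ → prefixed-≢T b c c′ U i) λ eq →
    c≢c′ (trans (sym (prefixed-T b c U)) (trans eq (prefixed-T b c′ U)))

  prefixed-ball : ∀ b c (u : S) → InBall (suc T) (spell (suc e) (prefixed b c (at u))) u
  prefixed-ball b c u = from (InBall⇔ (spell (suc e) (prefixed b c (at u))) u) (suc T , ≤-refl , λ i i+1+T<n →
    trans (at-spell (suc e) (prefixed b c (at u)) i+1+T<n)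
      (trans (cong (prefixed b c (at u)) (+-comm i (suc T))) (prefixed-> b c (at u) i)))

  at-spell-Good : ∀ X → Good X → Good (at (spell (suc e) X))
  at-spell-Good X = Good-resp {X} {at (spell (suc e) X)} λ i i≤e → sym (at-spell (suc e) X (s≤s i≤e))

  -- Equal identifying sets give this inclusion in both directions.
  Covers : S → S → Set
  Covers u v = ∀ w → InBall (suc T) w u → Good (at w) → ∃ λ k → k ≤ suc T × ShiftBy k w v

  module LateDifference {u v : S} (cov : Covers u v) {r k : ℕ} (r+k≡e : r + k ≡ e) (k≤T : k ≤ T)
    (u≡v : ∀ i → i < r → at u i ≡ at v i) (ur≢vr : at u r ≢ at v r)
    {b : A} (b≢u₀ : b ≢ at u 0) where

    private
      W = splice k (λ _ → b) (at u)
      w = spell (suc e) W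

      w-< : ∀ {i} → i < k → at w i ≡ b
      w-< {i} i<k = trans (at-spell (suc e) W (≤-trans (<⇒≤ (s≤s i<k)) (s≤s (≤-trans k≤T (<⇒≤ T<e))))) (splice-< k _ _ i<k)

      w-≥ : ∀ {i} → i + k < suc e → at w (i + k) ≡ at u i
      w-≥ {i} i+k<n = trans (at-spell (suc e) W i+k<n) (trans (cong W (+-comm i k)) (splice-+ k _ _ i))

      0<r : 0 < r
      0<r = ≤-cert T (+-mono-≤ 1+2T≤e (+-mono-≤ k≤T (≤-reflexive (sym r+k≡e)))) (solve (T ∷ r ∷ k ∷ e ∷ []))

    -- If `w` were in the code, it would reach `v` in some `j` steps. For `j < k` the prefix letter
    -- `b` would have to be the common first letter of `u` and `v`; for `j = k` the difference at
    -- `r` would vanish; for `j > k` the word is periodic.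
    late-¬Good : ¬ Good W
    late-¬Good good with cov w (from (InBall⇔ w u) (k , m≤n⇒m≤1+n k≤T , λ i → w-≥)) (at-spell-Good W good)
    ... | j , j≤1+T , sh with <-cmp j k
    ...   | tri< j<k _ _ = b≢u₀ (trans (sym (w-< j<k)) (trans (sh 0 (≤-trans (s≤s j≤1+T) (s≤s T<e))) (sym (u≡v 0 0<r))))
    ...   | tri≈ _ refl _ = ur≢vr (trans (sym (w-≥ r+k<n)) (sh r r+k<n))
      where r+k<n = s≤s (≤-reflexive r+k≡e)
    -- `u` and `v` both occur in `w`, displaced by `s = j - k`, and agree below `r`; this gives the
    -- period `s` all the way to `e`.
    ...   | tri> _ _ k<j with m≤n⇒∃[o]m+o≡n (<⇒≤ k<j)
    ...     | s , refl = periodic⇒¬Good {at w} s 0<s (≤-trans (m≤n+m s k) j≤1+T)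
      (≤-cert k (+-mono-≤ j≤1+T 1+2T≤e) (solve (T ∷ s ∷ k ∷ e ∷ []))) per
      (at-spell-Good W good)
      where
      0<s : 0 < s
      0<s = ≤-cert 0 k<j (solve (k ∷ s ∷ []))
      per : ∀ i j → i + s ≡ j → T < j → j ≤ e → at w i ≡ at w j
      per i _ refl T<i+s i+s≤e with m≤n⇒∃[o]m+o≡n {k} {i} (≤-cert 0 (+-mono-≤ j≤1+T T<i+s) (solve (T ∷ s ∷ k ∷ i ∷ [])))
      ... | i′ , refl = begin
        at w (k + i′)        ≡⟨ cong (at w) (+-comm k i′) ⟩
        at w (i′ + k)        ≡⟨ w-≥ (s≤s (≤-trans (≤-reflexive (+-comm i′ k)) (≤-trans (m≤m+n (k + i′) s) i+s≤e))) ⟩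
        at u i′              ≡⟨ u≡v i′ (≤-cert 0 (+-mono-≤ i+s≤e (+-mono-≤ (≤-reflexive (sym r+k≡e)) 0<s)) (solve (k ∷ i′ ∷ s ∷ r ∷ e ∷ []))) ⟩
        at v i′              ≡⟨ sh i′ (s≤s (≤-trans (≤-reflexive (sym (k+i+s k i′ s))) i+s≤e)) ⟨
        at w (i′ + (k + s))  ≡⟨ cong (at w) (k+i+s k i′ s) ⟨
        at w (k + i′ + s)    ∎
        where
        open ≡-Reasoning
        k+i+s : ∀ k i s → k + i + s ≡ i + (k + s)
        k+i+s = solve-∀

  module EarlyDifference {u v : S} (cov : Covers u v) {r : ℕ} (r+1+T≤e : r + suc T ≤ e)
    (ur≢vr : at u r ≢ at v r) where

    private
      W : A → A → Word
      W b c = prefixed b c (at u)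

      w : A → A → S
      w b c = spell (suc e) (W b c)

    -- Distance `T + 1` would align `u` with `v` at `r`, where they differ, and a distance below `T`
    -- would make `b` the first letter of `v`.
    early-shift : ∀ {b c} → b ≢ at v 0 → Good (W b c) →
      ShiftBy T (w b c) v
    early-shift {b} {c} b≢v₀ good with cov (w b c) (prefixed-ball b c u) (at-spell-Good (W b c) good)
    ... | j , j≤1+T , sh with m≤n⇒m<n∨m≡n j≤1+T
    ...   | inj₂ refl = contradiction
      (trans (sym (trans (cong (W b c) (+-comm r (suc T))) (prefixed-> b c (at u) r)))
        (trans (sym (at-spell (suc e) (W b c) (s≤s r+1+T≤e))) (sh r (s≤s r+1+T≤e)))) ur≢vr
    ...   | inj₁ (s≤s j≤T) with m≤n⇒m<n∨m≡n j≤T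
    ...     | inj₁ j<T = contradiction
      (trans (sym (prefixed-< b c (at u) j<T)) (trans (sym (at-spell (suc e) (W b c) j<n)) (sh 0 j<n))) b≢v₀
      where
      j<n = <-trans j<T (m≤n⇒m≤1+n T<e)
    ...     | inj₂ refl = sh

    early-¬Good : ∀ {b c} → b ≢ at v 0 → c ≢ at v 0 → ¬ Good (W b c)
    early-¬Good {b} {c} b≢v₀ c≢v₀ good = c≢v₀ (trans (sym (prefixed-T b c (at u)))
      (trans (sym (at-spell (suc e) (W b c) T<n)) (early-shift b≢v₀ good 0 T<n)))
      where
      T<n = m≤n⇒m≤1+n T<e

    -- Of the two choices `b` and `at v 0` for `c`, one is `Good`, and `early-¬Good` leaves the
    -- second. That string lies `T + 1` steps from `u` and `T` steps from `v`, so `u` sits one place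
    -- further left than in `v`.
    early-link : ∀ i → i + suc T ≤ e → at u i ≡ at v (suc i)
    early-link i i+1+T≤e with other (at v 0)
    ... | b , b≢v₀ with Good-prefixed b b (at v 0) (at u) b≢v₀
    ...   | inj₁ good = contradiction good (early-¬Good b≢v₀ b≢v₀)
    ...   | inj₂ good = trans (sym (prefixed-> b (at v 0) (at u) i))
      (trans (cong (W b (at v 0)) (trans (+-comm (suc T) i) (+-suc i T)))
      (trans (sym (at-spell (suc e) (W b (at v 0)) lt)) (early-shift b≢v₀ good (suc i) lt)))
      where
      lt : suc i + T < suc e
      lt = s≤s (subst (_≤ e) (+-suc i T) i+1+T≤e)

  -- The links in both directions make `u` and `v` alternate between their two first letters, up to
  -- position `e - T`. Prefixing `u` with copies of its own first letter then gives a member of the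
  -- code that `early-¬Good` forbids.
  early-¬Covers : ∀ {u v r} → r + suc T ≤ e → at u r ≢ at v r → Covers u v → Covers v u → ⊥
  early-¬Covers {u} {v} {r} r+1+T≤e ur≢vr cuv cvu = early-¬Good u₀≢v₀ u₀≢v₀ good
    where
    open EarlyDifference {u} {v} cuv r+1+T≤e ur≢vr
    open EarlyDifference {v} {u} cvu r+1+T≤e (ur≢vr ∘ sym) using () renaming (early-link to early-link′)

    u₀≢v₀ : at u 0 ≢ at v 0
    -- Equal first letters would propagate along the links as far as `r`.
    u₀≢v₀ u₀≡v₀ = ur≢vr (constant r r+1+T≤e)
      where
      constant : ∀ i → i + suc T ≤ e → at u i ≡ at v i
      constant zero    _ = u₀≡v₀
      constant (suc i) lt = let lt′ = <⇒≤ lt in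
        trans (sym (early-link′ i lt′)) (trans (sym (constant i lt′)) (early-link i lt′))

    0+1+T≤e : 0 + suc T ≤ e
    0+1+T≤e = T<e

    good : Good (prefixed (at u 0) (at u 0) (at u))
    good = alternating⇒Good (m+[n∸m]≡n 0<T) T+2<e u₀≢v₀
      (prefixed-< _ _ (at u) (∸-monoʳ-< z<s 0<T))
      (prefixed-T _ _ (at u))
      (trans (cong P (sym (+-identityʳ (suc T)))) (prefixed-> _ _ (at u) 0))
      (trans (cong P (+-comm 1 (suc T))) (trans (prefixed-> _ _ (at u) 1) (sym (early-link′ 0 0+1+T≤e))))
      alternates
      where
      P = prefixed (at u 0) (at u 0) (at u)
      alternates : ∀ i → T < i → 2 + i ≤ e → P i ≡ P (2 + i)
      alternates i T<i 2+i≤e with m≤n⇒∃[o]m+o≡n T<i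
      ... | j , refl = begin
        P (suc T + j)        ≡⟨ prefixed-> _ _ (at u) j ⟩
        at u j               ≡⟨ early-link j (≤-cert 2 2+i≤e (solve (j ∷ T ∷ e ∷ []))) ⟩
        at v (suc j)         ≡⟨ early-link′ (suc j) (≤-cert 1 2+i≤e (solve (j ∷ T ∷ e ∷ []))) ⟩
        at u (2 + j)         ≡⟨ prefixed-> _ _ (at u) (2 + j) ⟨
        P (suc T + (2 + j))  ≡⟨ cong P (solve (T ∷ j ∷ [])) ⟩
        P (2 + (suc T + j))  ∎
        where open ≡-Reasoning

  late-¬Covers : ∀ {u v r} → r ≤ e → e < r + suc T → (∀ i → i < r → at u i ≡ at v i) →
    at u r ≢ at v r → Covers u v → Covers v u → ⊥
  late-¬Covers {u} {v} {r} r≤e e<r+1+T u≡v ur≢vr cuv cvu with m≤n⇒∃[o]m+o≡n r≤e | other (at u 0)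
  ... | k , refl | b , b≢u₀ = [ LateDifference.late-¬Good {u} {v} cuv refl k≤T u≡v ur≢vr b≢u₀
      , LateDifference.late-¬Good {v} {u} cvu refl k≤T (λ i i<r → sym (u≡v i i<r)) (ur≢vr ∘ sym)
          (subst (b ≢_) (u≡v 0 0<r) b≢u₀) ]′
      (Good-last (W u) (W v) agree λ eq → ur≢vr (trans (sym (at-r u)) (trans eq (at-r v))))
    where
    k≤T : k ≤ T
    k≤T = ≤-cert 0 e<r+1+T (solve (r ∷ k ∷ T ∷ []))
    0<r : 0 < r
    0<r = ≤-cert T (+-mono-≤ 1+2T≤e k≤T) (solve (r ∷ k ∷ T ∷ []))
    W : S → Word
    W x = splice k (λ _ → b) (at x)
    at-r : ∀ x → W x (r + k) ≡ at x r
    at-r x = trans (cong (W x) (+-comm r k)) (splice-+ k _ _ r)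
    agree : ∀ i → i < r + k → W u i ≡ W v i
    agree i i<e with i <? k
    ... | yes i<k = trans (splice-< k _ _ i<k) (sym (splice-< k _ _ i<k))
    ... | no i≮k with m≤n⇒∃[o]m+o≡n (≮⇒≥ i≮k)
    ...   | j , refl = trans (splice-+ k _ _ j)
      (trans (u≡v j (≤-cert 0 i<e (solve (k ∷ j ∷ r ∷ [])))) (sym (splice-+ k _ _ j)))

  separated : ∀ {u v} → u ≢ v → Covers u v → Covers v u → ⊥
  separated {u} {v} u≢v cuv cvu with least (λ r → ¬? (at u r Fin.≟ at v r)) (suc e)
  ... | inj₂ none = u≢v (at-ext u v λ i i<n → decidable-stable (at u i Fin.≟ at v i) (none i i<n))
  ... | inj₁ (r , s≤s r≤e , ur≢vr , min) with r + suc T ≤? e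
  ...   | yes early = early-¬Covers early ur≢vr cuv cvu
  ...   | no late = late-¬Covers r≤e (≰⇒> late)
      (λ i i<r → decidable-stable (at u i Fin.≟ at v i) (min i i<r)) ur≢vr cuv cvu

  covered : ∀ v → ∃ λ w → InBall (suc T) w v × Good (at w)
  covered v with Good-prefixed zero zero (suc zero) (at v) (λ ())
  ... | inj₁ good = _ , prefixed-ball zero zero v , at-spell-Good (prefixed zero zero (at v)) good
  ... | inj₂ good = _ , prefixed-ball zero (suc zero) v , at-spell-Good (prefixed zero (suc zero) (at v)) good

  open Membership {suc D} T e T<e using (InS⇔Good) public

  InS-code : IsIdCode (suc T) (InS {suc (suc D)} {suc e} (suc T))
  InS-code = (λ v → let w , ball , good = covered v in w , ball , from (InS⇔Good w) good)
    , λ u v u≢v same → separated u≢v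
        (λ w ball good → to (InBall⇔ w v) (proj₁ (to (same w) (ball , from (InS⇔Good w) good))))
        (λ w ball good → to (InBall⇔ w u) (proj₁ (from (same w) (ball , from (InS⇔Good w) good))))

-- Lists of strings with one excluded last letter per prefix.

length-cartesianProductWith : ∀ {A B C : Set} (f : A → B → C) xs ys →
  length (cartesianProductWith f xs ys) ≡ length xs * length ys
length-cartesianProductWith f []       ys = refl
length-cartesianProductWith f (x ∷ xs) ys = trans (length-++ (L.map (f x) ys))
  (cong₂ _+_ (length-map (f x) ys) (length-cartesianProductWith f xs ys))

Unique-⊆⇒length≤ : ∀ {A : Set} {xs ys : List A} → Unique xs → (∀ {x} → x ∈ xs → x ∈ ys) →
  length xs ≤ length ys
Unique-⊆⇒length≤ AllPairs.[] xs⊆ys = z≤n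
Unique-⊆⇒length≤ {xs = x ∷ xs} (x∉xs AllPairs.∷ xs!) xs⊆ys with ∈-∃++ (xs⊆ys (here refl))
... | as , bs , refl = ≤-trans (s≤s (Unique-⊆⇒length≤ xs! xs⊆as++bs))
  (≤-reflexive (sym (length-++-sucʳ as x bs)))
  where
  xs⊆as++bs : ∀ {z} → z ∈ xs → z ∈ as L.++ bs
  xs⊆as++bs z∈xs with ∈-++⁻ as (xs⊆ys (there z∈xs))
  ... | inj₁ z∈as = ∈-++⁺ˡ z∈as
  ... | inj₂ (here refl) = contradiction refl (All.lookup x∉xs z∈xs)
  ... | inj₂ (there z∈bs) = ∈-++⁺ʳ as z∈bs

module _ (d : ℕ) where

  strings : ∀ n → List (Str d n)
  strings zero    = V.[] ∷ []
  strings (suc n) = cartesianProductWith V._∷_ (allFin d) (strings n)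

  ∈-strings : ∀ {n} (x : Str d n) → x ∈ strings n
  ∈-strings V.[]       = here refl
  ∈-strings (c V.∷ x) = ∈-cartesianProductWith⁺ V._∷_ (∈-allFin c) (∈-strings x)

  strings-unique : ∀ n → Unique (strings n)
  strings-unique zero    = All.[] AllPairs.∷ AllPairs.[]
  strings-unique (suc n) = Unique.cartesianProductWith⁺ V._∷_ Vec.∷-injective
    (Unique.allFin⁺ d) (strings-unique n)

  length-strings : ∀ n → length (strings n) ≡ d ^ n
  length-strings zero    = refl
  length-strings (suc n) = trans (length-cartesianProductWith V._∷_ (allFin d) (strings n))
    (cong₂ _*_ (length-tabulate {n = d} (λ i → i)) (length-strings n))

module _ {D e : ℕ} (g : Str (suc D) e → Fin (suc D)) where

  private
    extend : Str (suc D) e → Fin D → Str (suc D) (suc e)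
    extend p j = p ∷ʳ Fin.punchIn (g p) j

    extend-injective : ∀ {p q i j} → extend p i ≡ extend q j → p ≡ q × i ≡ j
    extend-injective {p} {q} {i} {j} eq with Vec.∷ʳ-injective p q eq
    ... | refl , eq′ = refl , Fin.punchIn-injective (g p) i j eq′

  -- Used twice: with the forbidden letter for `g` it lists the code, and with a letter absent from
  -- an arbitrary code it lists strings which that code must contain.
  avoiding : List (Str (suc D) (suc e))
  avoiding = cartesianProductWith extend (strings (suc D) e) (allFin D)

  avoiding-unique : Unique avoiding
  avoiding-unique = Unique.cartesianProductWith⁺ extend extend-injective
    (strings-unique (suc D) e) (Unique.allFin⁺ D)

  length-avoiding : length avoiding ≡ suc D ^ e * D
  length-avoiding = trans (length-cartesianProductWith extend (strings (suc D) e) (allFin D))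
    (cong₂ _*_ (length-strings (suc D) e) (length-tabulate {n = D} (λ i → i)))

  ∈-avoiding : ∀ p {c} → (p ∷ʳ c) ∈ avoiding ⇔ c ≢ g p
  ∈-avoiding p {c} = mk⇔ to from
    where
    to : (p ∷ʳ c) ∈ avoiding → c ≢ g p
    to mem with ∈-cartesianProductWith⁻ extend (strings (suc D) e) (allFin D) mem
    ... | q , j , _ , _ , eq with Vec.∷ʳ-injective p q eq
    ...   | refl , refl = Fin.punchInᵢ≢i (g p) j
    from : c ≢ g p → (p ∷ʳ c) ∈ avoiding
    from c≢gp = subst (λ z → (p ∷ʳ z) ∈ avoiding) (Fin.punchIn-punchOut (c≢gp ∘ sym))
      (∈-cartesianProductWith⁺ extend (∈-strings (suc D) p) (∈-allFin (Fin.punchOut (c≢gp ∘ sym))))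

-- Size of the code and the lower bound.

module Counting {D : ℕ} (T e : ℕ) (0<T : 0 < T) (1+2T≤e : suc (T + T) ≤ e) (T+2<e : T + 2 < e) where

  open Code {D} T e 0<T 1+2T≤e T+2<e
  open Letters {suc D} T e using (forbidden-last)
  open Equivalence

  private
    S = Str (2+ D) (suc e)
    T<e = <-trans (m<m+n T z<s) T+2<e

  forbidden : Str (2+ D) e → Fin (2+ D)
  forbidden p = proj₁ (forbidden-last T<e (at p))

  InS⇔avoids : ∀ p c → InS (suc T) (p ∷ʳ c) ⇔ c ≢ forbidden p
  InS⇔avoids p c = subst (λ z → InS (suc T) (p ∷ʳ c) ⇔ z ≢ forbidden p) (at-∷ʳ-last p c)
    (⇔.trans (InS⇔Good (p ∷ʳ c)) (proj₂ (forbidden-last T<e (at p)) (at (p ∷ʳ c))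
      λ i i<e → sym (at-∷ʳ-< p c i<e)))

  InS-enumeration : Σ (List S) λ L → Unique L × (∀ x → (x ∈ L) ⇔ InS (suc T) x) ×
    length L ≡ (2+ D) ^ e * suc D
  InS-enumeration = avoiding forbidden , avoiding-unique forbidden , mem , length-avoiding forbidden
    where
    mem : ∀ x → (x ∈ avoiding forbidden) ⇔ InS (suc T) x
    mem x with V.initLast x
    ... | p , c , refl = ⇔.trans (∈-avoiding forbidden p) (⇔.sym (InS⇔avoids p c))

  -- If both siblings were outside `C`, `sibling-ball` would give them equal identifying sets. The
  -- double negation is there because `C` need not be decidable.
  siblings-meet-code : ∀ {C : S → Set} {t} → IsIdCode t C → ∀ p {c c′} → c ≢ c′ →
    ¬ C (p ∷ʳ c) → ¬ ¬ C (p ∷ʳ c′)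
  siblings-meet-code {C} {t} (_ , separates) p {c} {c′} c≢c′ ∉c ∉c′ =
    separates (p ∷ʳ c) (p ∷ʳ c′) (c≢c′ ∘ Vec.∷ʳ-injectiveʳ p p) λ w → mk⇔
      (λ (ball , w∈C) → sibling-ball {w = w} {p ∷ʳ c} {p ∷ʳ c′} (agree c c′) (λ { refl → ∉c w∈C }) ball , w∈C)
      (λ (ball , w∈C) → sibling-ball {w = w} {p ∷ʳ c′} {p ∷ʳ c} (agree c′ c) (λ { refl → ∉c′ w∈C }) ball , w∈C)
    where
    agree : ∀ c c′ i → i < e → at (p ∷ʳ c) i ≡ at (p ∷ʳ c′) i
    agree c c′ i i<e = trans (at-∷ʳ-< p c i<e) (sym (at-∷ʳ-< p c′ i<e))

  code-length : ∀ {t} (C : List S) → IsIdCode t (_∈ C) → (2+ D) ^ e * suc D ≤ length C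
  code-length C code = subst (_≤ length C) (length-avoiding missing)
    (Unique-⊆⇒length≤ (avoiding-unique missing) avoiding⊆C)
    where
    _∈C? : ∀ x → Dec (x ∈ C)
    x ∈C? = DecMembership._∈?_ (Vec.≡-dec Fin._≟_) x C

    absent? : ∀ p → Dec (∃ λ c → ¬ ((p ∷ʳ c) ∈ C))
    absent? p = Fin.any? λ c → ¬? ((p ∷ʳ c) ∈C?)

    pick : ∀ {p} → Dec (∃ λ c → ¬ ((p ∷ʳ c) ∈ C)) → Fin (2+ D)
    pick (yes (c , _)) = c
    -- No letter is absent here, so any value will do.
    pick (no _)        = zero

    missing : Str (2+ D) e → Fin (2+ D)
    missing p = pick (absent? p)

    present : ∀ p c (dec : Dec (∃ λ c → ¬ ((p ∷ʳ c) ∈ C))) → c ≢ pick dec → (p ∷ʳ c) ∈ C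
    present p c (yes (c′ , ∉C)) c≢c′ = decidable-stable ((p ∷ʳ c) ∈C?)
      (siblings-meet-code code p (c≢c′ ∘ sym) ∉C)
    present p c (no none) _ = decidable-stable ((p ∷ʳ c) ∈C?) λ ∉C → none (c , ∉C)

    avoiding⊆C : ∀ {x} → x ∈ avoiding missing → x ∈ C
    avoiding⊆C {x} mem with V.initLast x
    ... | p , c , refl = present p c (absent? p) (to (∈-avoiding missing p) mem)

theorem3p9 : (d t n : ℕ) → 2 ≤ d → 2 ≤ t → 5 ≤ n → t + t ≤ n →
    (IsIdCode t (InS {d} {n} t)
    × Σ (List (Str d n)) (λ L → Unique L × (∀ x → (x ∈ L) ⇔ InS t x)
    × length L ≡ d ^ (n ∸ 1) * (d ∸ 1)))
    × ((C : List (Str d n)) → Unique C → IsIdCode t (λ x → x ∈ C) →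
    d ^ (n ∸ 1) * (d ∸ 1) ≤ length C)
theorem3p9 (2+ D) (2+ s) (suc e) (s≤s (s≤s z≤n)) (s≤s (s≤s z≤n)) (s≤s 4≤e) (s≤s 2t≤n) =
  (InS-code , InS-enumeration) , λ C _ → code-length C
  where
  1+2T≤e : suc (suc s + suc s) ≤ e
  1+2T≤e = subst (_≤ e) (+-suc (suc s) (suc s)) 2t≤n

  -- For t = 2 this is the hypothesis n ≥ 5; for larger t it follows from n ≥ 2t.
  T+2<e : ∀ s → suc (suc s + suc s) ≤ e → suc s + 2 < e
  T+2<e zero    _ = 4≤e
  T+2<e (suc s) le = ≤-cert s le (solve (s ∷ e ∷ []))

  open Code {D} (suc s) e z<s 1+2T≤e (T+2<e s 1+2T≤e)
  open Counting {D} (suc s) e z<s 1+2T≤e (T+2<e s 1+2T≤e)
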